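{- Let $p\geq 3$ be prime and let $g\in\mathrm{SL}_2(\mathbf{F}_p)$ be a regular semisimple element with non-zero trace. Let $\mathrm{Cl}(g)\subset\mathrm{SL}_2(\overline{\mathbf{F}}_p)$ be the conjugacy class of $g$ in $\mathrm{SL}_2(\overline{\mathbf{F}}_p)$. If $H\subset\mathrm{SL}_2(\mathbf{F}_p)$ is a symmetric generating set of $\mathrm{SL}_2(\mathbf{F}_p)$ containing $1$, and $\alpha=|H\cdot H\cdot H|/|H|$, then $$|\mathrm{Cl}(g)\cap H|\leq 7\alpha^{2/3}|H|^{2/3}$$ unless $\alpha>|H|^{1/28}$.
   Context: An element of $\mathrm{SL}_2(\overline{\mathbf{F}}_p)$ is regular semisimple if it is semisimple with distinct eigenvalues (for $p\ne 2$ this means its trace $t$ satisfies $t^2\neq 4$). -}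

module Defs where

open import Level using (Level; _⊔_) renaming (suc to lsuc)
open import Data.Nat using (ℕ; zero; suc; NonZero)
import Data.Nat as N
open import Data.Nat.DivMod using (_mod_)
open import Data.Fin using (Fin; toℕ)
import Data.Fin.Properties as FinP
open import Data.Product using (Σ; ∃; _×_; _,_)
open import Data.Product.Properties using (≡-dec)
open import Data.List using (List; []; _∷_; _++_; foldr; deduplicate; concatMap; map; length)
open import Data.List.Membership.Propositional using (_∈_)
open import Data.List.Relation.Unary.All using (All)
open import Relation.Binary.PropositionalEquality using (_≡_)
open import Relation.Binary.Definitions using (DecidableEquality)
open import Relation.Nullary using (¬_)
open import Algebra.Bundles using (CommutativeRing)

-- 2x2 matrices over F_p, stored as (a , b , c , d) for [[a , b] , [c , d]];
-- F_p = Fin p with arithmetic mod p.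

Mat : ℕ → Set
Mat p = Fin p × Fin p × Fin p × Fin p

module _ (p : ℕ) {{_ : NonZero p}} where

  _⊗_ : Mat p → Mat p → Mat p
  (a , b , c , d) ⊗ (e , f , g , h) =
    ( (toℕ a N.* toℕ e N.+ toℕ b N.* toℕ g) mod p
    , (toℕ a N.* toℕ f N.+ toℕ b N.* toℕ h) mod p
    , (toℕ c N.* toℕ e N.+ toℕ d N.* toℕ g) mod p
    , (toℕ c N.* toℕ f N.+ toℕ d N.* toℕ h) mod p )

  IsSL : Mat p → Set
  IsSL (a , b , c , d) = (toℕ a N.* toℕ d) mod p ≡ (toℕ b N.* toℕ c N.+ 1) mod p

  one : Mat p
  one = (1 mod p , 0 mod p , 0 mod p , 1 mod p)

  neg : Fin p → Fin p
  neg x = (p N.∸ toℕ x) mod p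

  -- inverse of a determinant-one matrix: [[d , -b] , [-c , a]]
  inv : Mat p → Mat p
  inv (a , b , c , d) = (d , neg b , neg c , a)

  trℕ : Mat p → ℕ
  trℕ (a , b , c , d) = toℕ a N.+ toℕ d

  prod : List (Mat p) → Mat p
  prod = foldr _⊗_ one

  _≟M_ : DecidableEquality (Mat p)
  _≟M_ = ≡-dec FinP._≟_ (≡-dec FinP._≟_ (≡-dec FinP._≟_ FinP._≟_))

  HHH : List (Mat p) → List (Mat p)
  HHH H = deduplicate _≟M_
            (concatMap (λ x → concatMap (λ y → map (λ z → (x ⊗ y) ⊗ z) H) H) H)

  Generates : List (Mat p) → Set
  Generates H = ∀ m → IsSL m → Σ (List (Mat p)) λ w → All (_∈ H) w × prod w ≡ m

  Symmetric : List (Mat p) → Set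
  Symmetric H = ∀ {h} → h ∈ H → inv h ∈ H

-- Algebraically closed fields (standing in for \bar F_p)

module _ {c ℓ} (R : CommutativeRing c ℓ) where
  open CommutativeRing R

  evalPoly : List Carrier → Carrier → Carrier
  evalPoly cs x = foldr (λ a acc → a + x * acc) 0# cs

  natK : ℕ → Carrier
  natK zero = 0#
  natK (suc n) = 1# + natK n

record AlgClosedField (c ℓ : Level) : Set (lsuc (c ⊔ ℓ)) where
  field
    cring : CommutativeRing c ℓ
  open CommutativeRing cring
  field
    nontrivial : ¬ (1# ≈ 0#)
    inverse    : ∀ x → ¬ (x ≈ 0#) → ∃ λ y → x * y ≈ 1#
    closed     : ∀ a₀ (as : List Carrier) →
                 ∃ λ x → evalPoly cring (a₀ ∷ as ++ 1# ∷ []) x ≈ 0#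

-- K has characteristic p (for p prime and K nontrivial: exactly p)
HasChar : ∀ {c ℓ} → AlgClosedField c ℓ → ℕ → Set ℓ
HasChar K p = natK cring p ≈ 0#
  where open AlgClosedField K; open CommutativeRing cring

module _ {c ℓ} (K : AlgClosedField c ℓ) where
  open AlgClosedField K
  open CommutativeRing cring

  MatK : Set c
  MatK = Carrier × Carrier × Carrier × Carrier

  _⊗K_ : MatK → MatK → MatK
  (a , b , c , d) ⊗K (e , f , g , h) =
    (a * e + b * g , a * f + b * h , c * e + d * g , c * f + d * h)

  _≈M_ : MatK → MatK → Set ℓ
  (a , b , c , d) ≈M (e , f , g , h) = a ≈ e × b ≈ f × c ≈ g × d ≈ h

  detK : MatK → Carrier
  detK (a , b , c , d) = a * d - b * c

  -- inverse of a determinant-one matrix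
  invK : MatK → MatK
  invK (a , b , c , d) = (d , - b , - c , a)

  ιM : ∀ {p} → Mat p → MatK
  ιM (a , b , c , d) = (natK cring (toℕ a) , natK cring (toℕ b) , natK cring (toℕ c) , natK cring (toℕ d))

  ConjSL2K : ∀ {p} → Mat p → Mat p → Set (c ⊔ ℓ)
  ConjSL2K g h = Σ MatK λ x → detK x ≈ 1# × ((x ⊗K ιM g) ⊗K invK x) ≈M ιM h

{-# OPTIONS --safe #-}

-- Larsen–Pink argument.  Put C = {x ∈ SL₂(F_p) : tr x = t} and let L be the
-- part of Cl(g) in H, so that L ⊆ C ∩ H.  Consider (x, y, z) ↦ (xy, xz) from
-- L³ to (HHH)².  In a fibre over (a, b) the element x satisfies the linear
-- conditions tr x = tr (x⁻¹a) = tr (x⁻¹b) = t besides det x = 1.  Hence either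
-- three points of the fibre, or x⁻¹, y, z when 1, a, b are linearly dependent
-- (this needs t ≠ 0), are collinear points of the quadric C.  A line with three
-- points on C lies in C, and its direction is nilpotent, so x, y, z preserve a
-- common line v of F_p² unless two of x⁻¹, y, z coincide.  The coincidences
-- account for at most 3 |HHH|² triples, and the fibres without a common line
-- for at most 2 |HHH|².  For a common line v, some h ∈ H moves v because H
-- generates; then y h z together with the eigenvalues of y and z on v determines
-- y and z, which leaves at most 8 |HHH|² triples.  So |L|³ ≤ 13 |HHH|².

module Submission where

open import Defs
open import Level using (Level)
open import Algebra.Bundles using (CommutativeRing)
open import Algebra.Consequences.Propositional using (comm∧idˡ⇒id; comm∧invˡ⇒inv; comm∧distrʳ⇒distrˡ)
open import Algebra.Core using (Op₁; Op₂)
import Algebra.Solver.Ring as RingSolver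
open import Algebra.Solver.Ring.AlmostCommutativeRing
  using (fromCommutativeRing; _-Raw-AlmostCommutative⟶_)
open import Algebra.Structures using (IsCommutativeRing)
open import Data.Fin as Fin using (Fin; toℕ)
open import Data.Fin.Properties as Fin using (toℕ-fromℕ<; toℕ-injective; toℕ<n)
open import Data.Integer as ℤ using (ℤ; -[1+_]; _⊖_)
import Data.Integer.Properties as ℤ
open import Data.List using (List; []; _∷_; length; map; concatMap; filter; allFin; cartesianProduct)
open import Data.List.Membership.Propositional using (_∈_; find; lose)
open import Data.List.Membership.Propositional.Properties
  using (∈-map⁺; ∈-concatMap⁺; ∈-deduplicate⁺; ∈-filter⁺; ∈-allFin; ∈-cartesianProduct⁻)
open import Data.List.Properties using (length-++; length-map)
open import Data.List.Relation.Binary.Sublist.Propositional using (_⊆_; []; _∷_; _∷ʳ_)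
open import Data.List.Relation.Binary.Sublist.Propositional.Properties using (All-resp-⊆)
open import Data.List.Relation.Unary.All as All using (All; []; _∷_)
open import Data.List.Relation.Unary.All.Properties as Allₚ using (¬All⇒Any¬; all-filter)
open import Data.List.Relation.Unary.AllPairs using ([]; _∷_)
open import Data.List.Relation.Unary.Any as Any using (Any)
open import Data.List.Relation.Unary.Unique.Propositional using (Unique)
open import Data.List.Relation.Unary.Unique.Propositional.Properties as Uniqueₚ using (filter⁺; allFin⁺)
open import Data.Maybe.Base using (Maybe; just; nothing)
open import Data.Nat as ℕ using (ℕ; zero; suc; NonZero; _∸_; _%_; _/_)
open import Data.Nat.Coprimality using (coprime-Bézout; prime⇒coprime)
open import Data.Nat.DivMod
  using (_mod_; m%n<n; m<n⇒m%n≡m; n%n≡0; m*n%n≡0; [m+kn]%n≡m%n; m≡m%n+[m/n]*n; %-distribˡ-+; %-distribˡ-*)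
open import Data.Nat.GCD using (module Bézout)
open import Data.Nat.Primality using (Prime; prime⇒nonTrivial)
import Data.Nat.Properties as ℕ
open import Data.Nat.Tactic.RingSolver using (solve-∀)
open import Data.Product using (_×_; _,_; ∃; ∃₂; proj₁; proj₂)
open import Data.Product.Properties using (≡-dec)
open import Data.Sum using (_⊎_; inj₁; inj₂)
open import Relation.Binary.Definitions using (DecidableEquality)
open import Relation.Binary.PropositionalEquality as ≡ using (_≡_; _≢_)
open import Relation.Nullary using (¬_; Dec; yes; no; contradiction)
open import Relation.Nullary.Decidable using (_×-dec_)
open import Relation.Unary using (Pred; _∪_)

-- Integer coefficients for the ring solver.

module IntegerCoefficients {c ℓ} (R : CommutativeRing c ℓ) where
  open CommutativeRing R
  open import Data.Integer using (+_)
  open import Algebra.Properties.Ring ring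
  open import Algebra.Properties.AbelianGroup +-abelianGroup using (⁻¹-∙-comm)
  open import Algebra.Properties.Semiring.Mult.TCOptimised semiring
    using (1+×; ×-homo-+; ×1-homo-*) renaming (_×_ to _⋆_)
  open import Relation.Binary.Reasoning.Setoid setoid

  -- Here `_⋆_` is the variant of repeated addition for which `1 ⋆ 1#` computes to `1#` and `4 ⋆ 1#`
  -- to `1# + 1# + 1# + 1#`. Integer literals in solver equations therefore agree with the field
  -- terms by computation.
  fromℤ : ℤ → Carrier
  fromℤ (+ n)    = n ⋆ 1#
  fromℤ -[1+ n ] = - (suc n ⋆ 1#)

  fromℤ-⊖ : ∀ m n → fromℤ (m ⊖ n) ≈ m ⋆ 1# - n ⋆ 1#
  fromℤ-⊖ zero    zero    = sym (-‿inverseʳ 0#)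
  fromℤ-⊖ zero    (suc n) = sym (+-identityˡ _)
  fromℤ-⊖ (suc m) zero    = sym (trans (+-congˡ -0#≈0#) (+-identityʳ _))
  fromℤ-⊖ (suc m) (suc n) rewrite ℤ.[1+m]⊖[1+n]≡m⊖n m n = begin
    fromℤ (m ⊖ n)                          ≈⟨ fromℤ-⊖ m n ⟩
    m ⋆ 1# - n ⋆ 1#                        ≈⟨ +-congʳ (+-identityˡ _) ⟨
    0# + m ⋆ 1# - n ⋆ 1#                   ≈⟨ +-congʳ (+-congʳ (-‿inverseʳ 1#)) ⟨
    1# - 1# + m ⋆ 1# - n ⋆ 1#              ≈⟨ +-congʳ (+-assoc 1# _ _) ⟩
    1# + (- 1# + m ⋆ 1#) - n ⋆ 1#          ≈⟨ +-congʳ (+-congˡ (+-comm _ _)) ⟩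
    1# + (m ⋆ 1# - 1#) - n ⋆ 1#            ≈⟨ +-congʳ (+-assoc 1# _ _) ⟨
    1# + m ⋆ 1# - 1# - n ⋆ 1#              ≈⟨ +-assoc _ _ _ ⟩
    1# + m ⋆ 1# + (- 1# - n ⋆ 1#)          ≈⟨ +-congˡ (⁻¹-∙-comm 1# _) ⟩
    1# + m ⋆ 1# - (1# + n ⋆ 1#)            ≈⟨ +-cong (1+× m 1#) (-‿cong (1+× n 1#)) ⟨
    suc m ⋆ 1# - suc n ⋆ 1#                ∎

  fromℤ-+ : ∀ i j → fromℤ (i ℤ.+ j) ≈ fromℤ i + fromℤ j
  fromℤ-+ (+ m)    (+ n)    = ×-homo-+ 1# m n
  fromℤ-+ (+ m)    -[1+ n ] = fromℤ-⊖ m (suc n)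
  fromℤ-+ -[1+ m ] (+ n)    = trans (fromℤ-⊖ n (suc m)) (+-comm _ _)
  fromℤ-+ -[1+ m ] -[1+ n ] = begin
    - (suc (suc (m ℕ.+ n)) ⋆ 1#)      ≡⟨ ≡.cong (λ k → - (suc k ⋆ 1#)) (ℕ.+-suc m n) ⟨
    - ((suc m ℕ.+ suc n) ⋆ 1#)        ≈⟨ -‿cong (×-homo-+ 1# (suc m) (suc n)) ⟩
    - (suc m ⋆ 1# + suc n ⋆ 1#)       ≈⟨ ⁻¹-∙-comm _ _ ⟨
    - (suc m ⋆ 1#) - suc n ⋆ 1#       ∎

  fromℤ-neg : ∀ i → fromℤ (ℤ.- i) ≈ - fromℤ i
  fromℤ-neg (+ zero)  = sym -0#≈0#
  fromℤ-neg (+ suc n) = refl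
  fromℤ-neg -[1+ n ]  = sym (-‿involutive _)

  fromℤ-+* : ∀ m j → fromℤ (+ m ℤ.* j) ≈ m ⋆ 1# * fromℤ j
  fromℤ-+* m (+ n)    rewrite ≡.sym (ℤ.pos-* m n) = ×1-homo-* m n
  fromℤ-+* m -[1+ n ]
    rewrite ≡.sym (ℤ.neg-distribʳ-* (+ m) (+ suc n)) | ≡.sym (ℤ.pos-* m (suc n)) = begin
    fromℤ (ℤ.- + (m ℕ.* suc n))    ≈⟨ fromℤ-neg (+ (m ℕ.* suc n)) ⟩
    - ((m ℕ.* suc n) ⋆ 1#)         ≈⟨ -‿cong (×1-homo-* m (suc n)) ⟩
    - (m ⋆ 1# * (suc n ⋆ 1#))      ≈⟨ -‿distribʳ-* _ _ ⟩
    m ⋆ 1# * - (suc n ⋆ 1#)        ∎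

  fromℤ-* : ∀ i j → fromℤ (i ℤ.* j) ≈ fromℤ i * fromℤ j
  fromℤ-* (+ m)    j = fromℤ-+* m j
  fromℤ-* -[1+ m ] j rewrite ≡.sym (ℤ.neg-distribˡ-* (+ suc m) j) = begin
    fromℤ (ℤ.- (+ suc m ℤ.* j))  ≈⟨ fromℤ-neg (+ suc m ℤ.* j) ⟩
    - fromℤ (+ suc m ℤ.* j)      ≈⟨ -‿cong (fromℤ-+* (suc m) j) ⟩
    - (suc m ⋆ 1# * fromℤ j)     ≈⟨ -‿distribˡ-* _ _ ⟩
    - (suc m ⋆ 1#) * fromℤ j     ∎

  fromℤ-morphism : ℤ.+-*-rawRing -Raw-AlmostCommutative⟶ fromCommutativeRing R
  fromℤ-morphism = record
    { ⟦_⟧    = fromℤ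
    ; +-homo = fromℤ-+
    ; *-homo = fromℤ-*
    ; -‿homo = fromℤ-neg
    ; 0-homo = refl
    ; 1-homo = refl
    }

  _≟ᶜ_ : ∀ i j → Maybe (fromℤ i ≈ fromℤ j)
  i ≟ᶜ j with i ℤ.≟ j
  ... | yes i≡j = just (reflexive (≡.cong fromℤ i≡j))
  ... | no  _   = nothing

  -- Integer rather than ring coefficients let the normaliser cancel x - x
  -- in a ring without decidable equality.
  open RingSolver ℤ.+-*-rawRing (fromCommutativeRing R) fromℤ-morphism _≟ᶜ_ public
    using (solve; _:=_; _:+_; _:*_; _:-_; :-_; con; Polynomial)

  lit : ∀ {n} → ℕ → Polynomial n
  lit k = con (+ k)

-- Fields with decidable equality, linear certificates and cancellation.

record DecidableField : Set₁ where
  infixl 6 _+_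
  infixl 7 _*_
  infix  8 -_
  infix  4 _≟_
  field
    Carrier           : Set
    _+_ _*_           : Op₂ Carrier
    -_                : Op₁ Carrier
    0# 1#             : Carrier
    isCommutativeRing : IsCommutativeRing _≡_ _+_ _*_ -_ 0# 1#
    _≟_               : DecidableEquality Carrier
    inverse           : ∀ x → x ≢ 0# → ∃ λ y → x * y ≡ 1#
    1≢0               : 1# ≢ 0#

  commutativeRing : CommutativeRing _ _
  commutativeRing = record { isCommutativeRing = isCommutativeRing }

module SpecialLinear₂ (𝔽 : DecidableField) where
  open DecidableField 𝔽
  open ≡ using (refl; sym; trans; cong; cong₂; subst)
  open ≡.≡-Reasoning
  open CommutativeRing commutativeRing
    using (ring; +-group; zeroˡ; zeroʳ; _-_; *-identityˡ; *-assoc)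
  open import Algebra.Properties.Group +-group using (x∙y⁻¹≈ε⇒x≈y)
  open import Algebra.Properties.Ring ring using (-‿involutive)
  open IntegerCoefficients commutativeRing using (solve; _:=_; _:+_; _:*_; _:-_; :-_; lit)

  F V M : Set
  F = Carrier
  V = F × F
  M = F × F × F × F

  -- The multipliers kᵢ certify that l ≡ r is a consequence of the lᵢ ≡ rᵢ; the
  -- certificate itself is a ring identity.

  linear₁ : ∀ {l r l₁ r₁} k₁ → l₁ ≡ r₁ → l - r ≡ k₁ * (l₁ - r₁) → l ≡ r
  linear₁ {l₁ = l₁} k₁ refl eq = x∙y⁻¹≈ε⇒x≈y _ _
    (trans eq (solve 2 (λ k l → k :* (l :- l) := lit 0) refl k₁ l₁))

  +-vanishing : ∀ s k l → s + k * (l - l) ≡ s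
  +-vanishing = solve 3 (λ s k l → s :+ k :* (l :- l) := s) refl

  linear₂ : ∀ {l r l₁ r₁ l₂ r₂} k₁ k₂ → l₁ ≡ r₁ → l₂ ≡ r₂ →
            l - r ≡ k₁ * (l₁ - r₁) + k₂ * (l₂ - r₂) → l ≡ r
  linear₂ k₁ k₂ e₁ refl eq = linear₁ k₁ e₁ (trans eq (+-vanishing _ k₂ _))

  linear₃ : ∀ {l r l₁ r₁ l₂ r₂ l₃ r₃} k₁ k₂ k₃ → l₁ ≡ r₁ → l₂ ≡ r₂ → l₃ ≡ r₃ →
            l - r ≡ k₁ * (l₁ - r₁) + k₂ * (l₂ - r₂) + k₃ * (l₃ - r₃) → l ≡ r
  linear₃ k₁ k₂ k₃ e₁ e₂ refl eq = linear₂ k₁ k₂ e₁ e₂ (trans eq (+-vanishing _ k₃ _))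

  *-cancelˡ-0 : ∀ {x y} → x ≢ 0# → x * y ≡ 0# → y ≡ 0#
  *-cancelˡ-0 {x} {y} x≢0 xy≡0 with inverse x x≢0
  ... | x⁻¹ , xx⁻¹≡1 = linear₂ x⁻¹ (- y) xy≡0 xx⁻¹≡1
    (solve 3 (λ x y i → y :- lit 0 :=
                        i :* (x :* y :- lit 0) :+ :- y :* (x :* i :- lit 1)) refl x y x⁻¹)

  *-cancelˡ : ∀ {x y z} → x ≢ 0# → x * y ≡ x * z → y ≡ z
  *-cancelˡ {x} {y} {z} x≢0 eq = x∙y⁻¹≈ε⇒x≈y _ _ (*-cancelˡ-0 x≢0 (linear₁ 1# eq
    (solve 3 (λ x y z → x :* (y :- z) :- lit 0 := lit 1 :* (x :* y :- x :* z)) refl x y z)))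

  x*x≡0⇒x≡0 : ∀ {x} → x * x ≡ 0# → x ≡ 0#
  x*x≡0⇒x≡0 {x} xx≡0 with x ≟ 0#
  ... | yes x≡0 = x≡0
  ... | no  x≢0 = *-cancelˡ-0 x≢0 xx≡0

  -- Two by two matrices acting on the plane.

  infixr 7 _•_ _·_

  _•_ : F → V → V
  k • (v₁ , v₂) = k * v₁ , k * v₂

  _·_ : M → V → V
  (a , b , c , d) · (v₁ , v₂) = a * v₁ + b * v₂ , c * v₁ + d * v₂

  infixl 7 _⊗ᶠ_
  _⊗ᶠ_ : M → M → M
  (a , b , c , d) ⊗ᶠ (e , f , g , h) = a * e + b * g , a * f + b * h , c * e + d * g , c * f + d * h

  det tr : M → F
  det (a , b , c , d) = a * d - b * c
  tr  (a , b , c , d) = a + d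

  adj : M → M
  adj (a , b , c , d) = d , - b , - c , a

  _∧_ : V → V → F
  (v₁ , v₂) ∧ (w₁ , w₂) = v₁ * w₂ - v₂ * w₁

  V-≡ : {v w : V} → proj₁ v ≡ proj₁ w → proj₂ v ≡ proj₂ w → v ≡ w
  V-≡ refl refl = refl

  M-≡ : ∀ {a b c d e f g h : F} → a ≡ e → b ≡ f → c ≡ g → d ≡ h →
        _≡_ {A = M} (a , b , c , d) (e , f , g , h)
  M-≡ refl refl refl refl = refl

  ·-⊗ : ∀ x y v → (x ⊗ᶠ y) · v ≡ x · y · v
  ·-⊗ (a , b , c , d) (e , f , g , h) (v₁ , v₂) = V-≡ (row a b) (row c d)
    where
    row : ∀ a b → (a * e + b * g) * v₁ + (a * f + b * h) * v₂ ≡ a * (e * v₁ + f * v₂) + b * (g * v₁ + h * v₂)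
    row a b = solve 8 (λ a b e f g h u v →
      (a :* e :+ b :* g) :* u :+ (a :* f :+ b :* h) :* v :=
      a :* (e :* u :+ f :* v) :+ b :* (g :* u :+ h :* v)) refl a b e f g h v₁ v₂

  ·-• : ∀ x k v → x · (k • v) ≡ k • (x · v)
  ·-• (a , b , c , d) k (v₁ , v₂) = V-≡ (row a b) (row c d)
    where
    row : ∀ a b → a * (k * v₁) + b * (k * v₂) ≡ k * (a * v₁ + b * v₂)
    row a b = solve 5 (λ a b k u v →
      a :* (k :* u) :+ b :* (k :* v) := k :* (a :* u :+ b :* v)) refl a b k v₁ v₂

  •-• : ∀ k l v → k • (l • v) ≡ (k * l) • v
  •-• k l (v₁ , v₂) = V-≡ (sym (*-assoc k l v₁)) (sym (*-assoc k l v₂))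

  •-cancelˡ : ∀ {k v w} → k ≢ 0# → k • v ≡ k • w → v ≡ w
  •-cancelˡ k≢0 eq = V-≡ (*-cancelˡ k≢0 (cong proj₁ eq)) (*-cancelˡ k≢0 (cong proj₂ eq))

  -- `IsSL` avoids subtraction and says ad = bc + 1; the certificates below work with `det` instead.
  det≡1 : ∀ {a b c d} → a * d ≡ b * c + 1# → det (a , b , c , d) ≡ 1#
  det≡1 {a} {b} {c} {d} eq = linear₁ 1# eq (solve 4 (λ a b c d →
    a :* d :- b :* c :- lit 1 := lit 1 :* (a :* d :- (b :* c :+ lit 1))) refl a b c d)

  -- Places the two elementary unipotents in SL₂, so that a generating set has to produce them.
  shear : ∀ {b c} → b ≡ 0# ⊎ c ≡ 0# → 1# * 1# ≡ b * c + 1#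
  shear {c = c} (inj₁ refl) = solve 1 (λ c → lit 1 :* lit 1 := lit 0 :* c :+ lit 1) refl c
  shear {b = b} (inj₂ refl) = solve 1 (λ b → lit 1 :* lit 1 := b :* lit 0 :+ lit 1) refl b

  det-⊗ : ∀ x y → det (x ⊗ᶠ y) ≡ det x * det y
  det-⊗ (a , b , c , d) (e , f , g , h) = solve 8 (λ a b c d e f g h →
    (a :* e :+ b :* g) :* (c :* f :+ d :* h) :- (a :* f :+ b :* h) :* (c :* e :+ d :* g) :=
    (a :* d :- b :* c) :* (e :* h :- f :* g)) refl a b c d e f g h

  det-⊗≡1 : ∀ {x y} → det x ≡ 1# → det y ≡ 1# → det (x ⊗ᶠ y) ≡ 1#
  det-⊗≡1 {x} {y} p q = trans (det-⊗ x y) (trans (cong₂ _*_ p q) (*-identityˡ 1#))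

  ⊗ᶠ-identityʳ : ∀ x → x ⊗ᶠ (1# , 0# , 0# , 1#) ≡ x
  ⊗ᶠ-identityʳ (a , b , c , d) = M-≡ (left a b) (right a b) (left c d) (right c d)
    where
    left : ∀ a b → a * 1# + b * 0# ≡ a
    left = solve 2 (λ a b → a :* lit 1 :+ b :* lit 0 := a) refl
    right : ∀ a b → a * 0# + b * 1# ≡ b
    right = solve 2 (λ a b → a :* lit 0 :+ b :* lit 1 := b) refl

  adj-⊗ : ∀ x y → det x ≡ 1# → adj x ⊗ᶠ (x ⊗ᶠ y) ≡ y
  adj-⊗ (a , b , c , d) (e , f , g , h) det≡1 = M-≡ (top e g) (top f h) (bottom e g) (bottom f h)
    where
    top : ∀ e g → d * (a * e + b * g) + - b * (c * e + d * g) ≡ e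
    top e g = linear₁ e det≡1 (solve 6 (λ a b c d e g →
      d :* (a :* e :+ b :* g) :+ :- b :* (c :* e :+ d :* g) :- e :=
      e :* (a :* d :- b :* c :- lit 1)) refl a b c d e g)
    bottom : ∀ e g → - c * (a * e + b * g) + a * (c * e + d * g) ≡ g
    bottom e g = linear₁ g det≡1 (solve 6 (λ a b c d e g →
      :- c :* (a :* e :+ b :* g) :+ a :* (c :* e :+ d :* g) :- g :=
      g :* (a :* d :- b :* c :- lit 1)) refl a b c d e g)

  ⊗-cancelˡ : ∀ x {y z} → det x ≡ 1# → x ⊗ᶠ y ≡ x ⊗ᶠ z → y ≡ z
  ⊗-cancelˡ x {y} {z} det≡1 eq =
    trans (sym (adj-⊗ x y det≡1)) (trans (cong (adj x ⊗ᶠ_) eq) (adj-⊗ x z det≡1))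

  -- Cramer's rule, row by row: weighting the values on v and w by w₂ and -v₂ leaves v ∧ w times the
  -- first entry, and the weights -w₁ and v₁ leave v ∧ w times the second.
  agree-on-basis : ∀ {x y} v w → v ∧ w ≢ 0# → x · v ≡ y · v → x · w ≡ y · w → x ≡ y
  agree-on-basis {a , b , c , d} {e , f , g , h} (v₁ , v₂) (w₁ , w₂) v∧w≢0 xv≡yv xw≡yw =
    M-≡ (first a b e f (cong proj₁ xv≡yv) (cong proj₁ xw≡yw))
        (second a b e f (cong proj₁ xv≡yv) (cong proj₁ xw≡yw))
        (first c d g h (cong proj₂ xv≡yv) (cong proj₂ xw≡yw))
        (second c d g h (cong proj₂ xv≡yv) (cong proj₂ xw≡yw))
    where
    first : ∀ a b e f → a * v₁ + b * v₂ ≡ e * v₁ + f * v₂ → a * w₁ + b * w₂ ≡ e * w₁ + f * w₂ → a ≡ e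
    first a b e f eq₁ eq₂ = *-cancelˡ v∧w≢0 (linear₂ w₂ (- v₂) eq₁ eq₂
      (solve 8 (λ a b e f v₁ v₂ w₁ w₂ →
        (v₁ :* w₂ :- v₂ :* w₁) :* a :- (v₁ :* w₂ :- v₂ :* w₁) :* e :=
        w₂ :* ((a :* v₁ :+ b :* v₂) :- (e :* v₁ :+ f :* v₂)) :+
        :- v₂ :* ((a :* w₁ :+ b :* w₂) :- (e :* w₁ :+ f :* w₂))) refl a b e f v₁ v₂ w₁ w₂))
    second : ∀ a b e f → a * v₁ + b * v₂ ≡ e * v₁ + f * v₂ → a * w₁ + b * w₂ ≡ e * w₁ + f * w₂ → b ≡ f
    second a b e f eq₁ eq₂ = *-cancelˡ v∧w≢0 (linear₂ (- w₁) v₁ eq₁ eq₂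
      (solve 8 (λ a b e f v₁ v₂ w₁ w₂ →
        (v₁ :* w₂ :- v₂ :* w₁) :* b :- (v₁ :* w₂ :- v₂ :* w₁) :* f :=
        :- w₁ :* ((a :* v₁ :+ b :* v₂) :- (e :* v₁ :+ f :* v₂)) :+
        v₁ :* ((a :* w₁ :+ b :* w₂) :- (e :* w₁ :+ f :* w₂))) refl a b e f v₁ v₂ w₁ w₂))

  -- Eigenlines and eigenvalues.

  -- The projective line: nothing is the line of (0, 1), just z the line of (1, z).
  Line : Set
  Line = Maybe F

  rep : Line → V
  rep nothing  = 0# , 1#
  rep (just z) = 1# , z

  Eigen : M → F → Line → Set
  Eigen x λ′ v = x · rep v ≡ λ′ • rep v

  Fixes : Line → M → Set
  Fixes v x = ∃ λ λ′ → Eigen x λ′ v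

  Eigen-⊗ : ∀ v {x y k l} → Eigen x k v → Eigen y l v → Eigen (x ⊗ᶠ y) (l * k) v
  Eigen-⊗ v {x} {y} {k} {l} xv yv = begin
    (x ⊗ᶠ y) · rep v  ≡⟨ ·-⊗ x y (rep v) ⟩
    x · y · rep v     ≡⟨ cong (x ·_) yv ⟩
    x · (l • rep v)   ≡⟨ ·-• x l (rep v) ⟩
    l • (x · rep v)   ≡⟨ cong (l •_) xv ⟩
    l • (k • rep v)   ≡⟨ •-• l k (rep v) ⟩
    (l * k) • rep v   ∎

  Fixes-⊗ : ∀ v {x y} → Fixes v x → Fixes v y → Fixes v (x ⊗ᶠ y)
  Fixes-⊗ v (k , xv) (l , yv) = l * k , Eigen-⊗ v xv yv

  Fixes-I : ∀ v → Fixes v (1# , 0# , 0# , 1#)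
  Fixes-I v = 1# , V-≡
    (solve 2 (λ u w → lit 1 :* u :+ lit 0 :* w := lit 1 :* u) refl (proj₁ (rep v)) (proj₂ (rep v)))
    (solve 2 (λ u w → lit 0 :* u :+ lit 1 :* w := lit 1 :* w) refl (proj₁ (rep v)) (proj₂ (rep v)))

  -- Each line has a single normalised representative: (1, z) and (1, y) have wedge y - z, and the
  -- wedge of either with (0, 1) is ±1.
  ∧≡0⇒≡ : ∀ v w → rep v ∧ rep w ≡ 0# → v ≡ w
  ∧≡0⇒≡ nothing  nothing  _  = refl
  ∧≡0⇒≡ nothing  (just z) eq = contradiction (linear₁ (- 1#) eq
    (solve 1 (λ z → lit 1 :- lit 0 :=
      :- lit 1 :* ((lit 0 :* z :- lit 1 :* lit 1) :- lit 0)) refl z)) 1≢0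
  ∧≡0⇒≡ (just z) nothing  eq = contradiction (linear₁ 1# eq
    (solve 1 (λ z → lit 1 :- lit 0 :=
      lit 1 :* ((lit 1 :* lit 1 :- z :* lit 0) :- lit 0)) refl z)) 1≢0
  ∧≡0⇒≡ (just z) (just y) eq = cong just (linear₁ (- 1#) eq
    (solve 2 (λ z y → z :- y :=
      :- lit 1 :* ((lit 1 :* y :- z :* lit 1) :- lit 0)) refl z y))

  -- The eigenvalue is the coordinate of x (`rep v`) at the place where `rep v` has the entry 1.
  ∧≡0⇒Fixes : ∀ v x → rep v ∧ (x · rep v) ≡ 0# → Fixes v x
  ∧≡0⇒Fixes nothing (a , b , c , d) eq = d , V-≡
    (linear₁ (- 1#) eq (solve 4 (λ a b c d →
      (a :* lit 0 :+ b :* lit 1) :- d :* lit 0 := :- lit 1 :*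
      ((lit 0 :* (c :* lit 0 :+ d :* lit 1) :- lit 1 :* (a :* lit 0 :+ b :* lit 1)) :- lit 0))
      refl a b c d))
    (solve 2 (λ c d → c :* lit 0 :+ d :* lit 1 := d :* lit 1) refl c d)
  ∧≡0⇒Fixes (just z) (a , b , c , d) eq = a + b * z , V-≡
    (solve 3 (λ a b z → a :* lit 1 :+ b :* z := (a :+ b :* z) :* lit 1) refl a b z)
    (linear₁ 1# eq (solve 5 (λ a b c d z →
      (c :* lit 1 :+ d :* z) :- (a :+ b :* z) :* z := lit 1 :*
      ((lit 1 :* (c :* lit 1 :+ d :* z) :- z :* (a :* lit 1 :+ b :* z)) :- lit 0))
      refl a b c d z))

  -- The characteristic equation of a determinant-one matrix. Written as a product equal to 1, it
  -- also exhibits k as a unit.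
  Eigen⇒root : ∀ v x k → det x ≡ 1# → Eigen x k v → k * (tr x - k) ≡ 1#
  Eigen⇒root nothing (a , b , c , d) k det≡1 eq =
    linear₃ (- (a - k)) c 1# (cong proj₂ eq) (cong proj₁ eq) det≡1 (solve 5 (λ a b c d k →
      k :* (a :+ d :- k) :- lit 1 :=
      :- (a :- k) :* (c :* lit 0 :+ d :* lit 1 :- k :* lit 1) :+
      c :* (a :* lit 0 :+ b :* lit 1 :- k :* lit 0) :+
      lit 1 :* (a :* d :- b :* c :- lit 1)) refl a b c d k)
  Eigen⇒root (just z) (a , b , c , d) k det≡1 eq =
    linear₃ (- (d - k)) b 1# (cong proj₁ eq) (cong proj₂ eq) det≡1 (solve 6 (λ a b c d k z →
      k :* (a :+ d :- k) :- lit 1 :=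
      :- (d :- k) :* (a :* lit 1 :+ b :* z :- k :* lit 1) :+
      b :* (c :* lit 1 :+ d :* z :- k :* z) :+
      lit 1 :* (a :* d :- b :* c :- lit 1)) refl a b c d k z)

  root⇒≢0 : ∀ {t k} → k * (t - k) ≡ 1# → k ≢ 0#
  root⇒≢0 root refl = 1≢0 (trans (sym root) (zeroˡ _))

  -- Subtracting the two equations gives (k - l)(t - k - l) = 0.
  distinct-roots : ∀ {t k l} → k * (t - k) ≡ 1# → l * (t - l) ≡ 1# → k ≢ l → l ≡ t - k
  distinct-roots {t} {k} {l} k-root l-root k≢l = sym (x∙y⁻¹≈ε⇒x≈y _ _ (*-cancelˡ-0
    (λ k-l≡0 → k≢l (x∙y⁻¹≈ε⇒x≈y _ _ k-l≡0))
    (linear₂ 1# (- 1#) k-root l-root (solve 3 (λ t k l →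
      (k :- l) :* (t :- k :- l) :- lit 0 :=
      lit 1 :* (k :* (t :- k) :- lit 1) :+ :- lit 1 :* (l :* (t :- l) :- lit 1))
      refl t k l))))

  -- Two independent eigenvectors for the same k would make x the scalar matrix k; then k² = 1 and
  -- the squared trace is 4.
  eigenline-unique : ∀ {x k v w} → det x ≡ 1# → tr x * tr x ≢ 1# + 1# + 1# + 1# →
                     Eigen x k v → Eigen x k w → v ≡ w
  eigenline-unique {x} {k} {v} {w} det≡1 tr²≢4 xv xw with rep v ∧ rep w ≟ 0#
  ... | yes v∧w≡0 = ∧≡0⇒≡ v w v∧w≡0
  ... | no  v∧w≢0 = contradiction (tr²≡4 x≡kI det≡1) tr²≢4
    where
    kI : M
    kI = k , 0# , 0# , k
    kI· : ∀ u → kI · u ≡ k • u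
    kI· (u₁ , u₂) = V-≡
      (solve 3 (λ k u v → k :* u :+ lit 0 :* v := k :* u) refl k u₁ u₂)
      (solve 3 (λ k u v → lit 0 :* u :+ k :* v := k :* v) refl k u₁ u₂)
    x≡kI : x ≡ kI
    x≡kI = agree-on-basis (rep v) (rep w) v∧w≢0
      (trans xv (sym (kI· (rep v)))) (trans xw (sym (kI· (rep w))))
    tr²≡4 : ∀ {x} → x ≡ kI → det x ≡ 1# → tr x * tr x ≡ 1# + 1# + 1# + 1#
    tr²≡4 refl det≡1 = linear₁ (1# + 1# + 1# + 1#) det≡1 (solve 1 (λ k →
      (k :+ k) :* (k :+ k) :- lit 4 :=
      lit 4 :* (k :* k :- lit 0 :* lit 0 :- lit 1)) refl k)

  -- If h moves the line v, a matrix is determined by its values on v and h v.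
  sandwich-cancel : ∀ {v h x x′ y y′ k l} → ¬ Fixes v h → l ≢ 0# →
                    det h ≡ 1# → det x ≡ 1# →
                    Eigen x k v → Eigen x′ k v → Eigen y l v → Eigen y′ l v →
                    x ⊗ᶠ h ⊗ᶠ y ≡ x′ ⊗ᶠ h ⊗ᶠ y′ → x ≡ x′ × y ≡ y′
  sandwich-cancel {v} {h} {x} {x′} {y} {y′} {k} {l} v-moved l≢0 det-h det-x xv x′v yv y′v eq =
    x≡x′ , ⊗-cancelˡ (x ⊗ᶠ h) (det-⊗≡1 {x} {h} det-x det-h)
             (trans eq (cong (λ m → m ⊗ᶠ h ⊗ᶠ y′) (sym x≡x′)))
    where
    -- Since y only rescales v, by the nonzero l, the product x h y reveals the value of x on h v.
    on-hv : ∀ x y → Eigen y l v → l • (x · h · rep v) ≡ (x ⊗ᶠ h ⊗ᶠ y) · rep v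
    on-hv x y yv = begin
      l • (x · h · rep v)     ≡⟨ ·-• x l (h · rep v) ⟨
      x · (l • (h · rep v))   ≡⟨ cong (x ·_) (·-• h l (rep v)) ⟨
      x · h · (l • rep v)     ≡⟨ cong (λ u → x · h · u) yv ⟨
      x · h · y · rep v       ≡⟨ ·-⊗ x h (y · rep v) ⟨
      (x ⊗ᶠ h) · y · rep v    ≡⟨ ·-⊗ (x ⊗ᶠ h) y (rep v) ⟨
      (x ⊗ᶠ h ⊗ᶠ y) · rep v   ∎
    x≡x′ : x ≡ x′
    x≡x′ = agree-on-basis (rep v) (h · rep v) (λ eq₀ → v-moved (∧≡0⇒Fixes v h eq₀))
      (trans xv (sym x′v))
      (•-cancelˡ l≢0 (trans (on-hv x y yv) (trans (cong (_· rep v) eq) (sym (on-hv x′ y′ y′v)))))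

  -- The line need not be recorded in the code: x and its eigenvalue k already determine v, so both
  -- products contain the same h v and `sandwich-cancel` applies.
  code-injective : (h : Line → M) → (∀ v → ¬ Fixes v (h v)) → (∀ v → det (h v) ≡ 1#) →
    ∀ x y y′ z z′ v v′ k l m → tr x * tr x ≢ 1# + 1# + 1# + 1# →
    det x ≡ 1# → det y ≡ 1# → det z ≡ 1# →
    Eigen x k v → Eigen y l v → Eigen z m v → Eigen x k v′ → Eigen y′ l v′ → Eigen z′ m v′ →
    y ⊗ᶠ h v ⊗ᶠ z ≡ y′ ⊗ᶠ h v′ ⊗ᶠ z′ → y ≡ y′ × z ≡ z′
  code-injective h moves det-h x y y′ z z′ v v′ k l m tr²≢4 det-x det-y det-z xv yv zv xv′ yv′ zv′ eq
    with eigenline-unique {x} {k} {v} {v′} det-x tr²≢4 xv xv′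
  ... | refl = sandwich-cancel {v} {h v} {y} {y′} {z} {z′} {l} {m} (moves v)
    (root⇒≢0 (Eigen⇒root v z m det-z zv)) (det-h v) det-y yv yv′ zv zv′ eq

  -- The upper unipotent moves the line of (0, 1), and the lower one sends slope z to z + 1. Hence
  -- the stabiliser of a line is a proper subgroup.
  no-common-line : ∀ v → ¬ (Fixes v (1# , 1# , 0# , 1#) × Fixes v (1# , 0# , 1# , 1#))
  no-common-line nothing ((k , eq) , _) = contradiction (linear₁ 1# (cong proj₁ eq)
    (solve 1 (λ k → lit 1 :- lit 0 := lit 1 :*
      (lit 1 :* lit 0 :+ lit 1 :* lit 1 :- k :* lit 0)) refl k)) 1≢0
  no-common-line (just z) (_ , (k , eq)) = contradiction (linear₂ 1# (- z) (cong proj₂ eq) (cong proj₁ eq)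
    (solve 2 (λ k z → lit 1 :- lit 0 := lit 1 :*
      (lit 1 :* lit 1 :+ lit 1 :* z :- k :* z) :+
      :- z :* (lit 1 :* lit 1 :+ lit 0 :* z :- k :* lit 1)) refl k z)) 1≢0

  -- Vectors in three-space.

  V³ : Set
  V³ = F × F × F

  0³ : V³
  0³ = 0# , 0# , 0#

  _≟³_ : DecidableEquality V³
  _≟³_ = ≡-dec _≟_ (≡-dec _≟_ _≟_)

  infixr 7 _•³_
  _•³_ : F → V³ → V³
  k •³ (p , q , r) = k * p , k * q , k * r

  dot : V³ → V³ → F
  dot (p , q , r) (u , v , w) = p * u + q * v + r * w

  cross : V³ → V³ → V³
  cross (p , q , r) (u , v , w) = q * w - r * v , r * u - p * w , p * v - q * u

  V³-≡ : ∀ {p q r u v w : F} → p ≡ u → q ≡ v → r ≡ w → _≡_ {A = V³} (p , q , r) (u , v , w)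
  V³-≡ refl refl refl = refl

  pivot : ∀ {p q r u v w} → p ≢ 0# → p * v ≡ q * u → p * w ≡ r * u →
          ∃ λ k → u ≡ k * p × v ≡ k * q × w ≡ k * r
  pivot {p} {q} {r} {u} {v} {w} p≢0 pv≡qu pw≡ru with inverse p p≢0
  ... | i , pi≡1 = u * i
    , linear₁ (- u) pi≡1 (solve 3 (λ p u i → u :- u :* i :* p := :- u :* (p :* i :- lit 1)) refl p u i)
    , other pv≡qu , other pw≡ru
    where
    other : ∀ {q v} → p * v ≡ q * u → v ≡ u * i * q
    other {q} {v} eq = linear₂ i (- v) eq pi≡1 (solve 5 (λ p q u v i →
      v :- u :* i :* q := i :* (p :* v :- q :* u) :+ :- v :* (p :* i :- lit 1)) refl p q u v i)

  -- Divide by a nonzero coordinate of n; the three cases are cyclic rotations of `pivot`.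
  cross≡0⇒parallel : ∀ {n w} → n ≢ 0³ → cross n w ≡ 0³ → ∃ λ k → w ≡ k •³ n
  cross≡0⇒parallel {p , q , r} {u , v , w} n≢0 eq with p ≟ 0#
  ... | no p≢0 =
    let k , e₁ , e₂ , e₃ = pivot p≢0 (x∙y⁻¹≈ε⇒x≈y _ _ (cong (λ m → proj₂ (proj₂ m)) eq))
                                     (sym (x∙y⁻¹≈ε⇒x≈y _ _ (cong (λ m → proj₁ (proj₂ m)) eq)))
    in k , V³-≡ e₁ e₂ e₃
  ... | yes p≡0 with q ≟ 0#
  ...   | no q≢0 =
    let k , e₁ , e₂ , e₃ = pivot q≢0 (x∙y⁻¹≈ε⇒x≈y _ _ (cong proj₁ eq))
                                     (sym (x∙y⁻¹≈ε⇒x≈y _ _ (cong (λ m → proj₂ (proj₂ m)) eq)))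
    in k , V³-≡ e₃ e₁ e₂
  ...   | yes q≡0 with r ≟ 0#
  ...     | no r≢0 =
    let k , e₁ , e₂ , e₃ = pivot r≢0 (x∙y⁻¹≈ε⇒x≈y _ _ (cong (λ m → proj₁ (proj₂ m)) eq))
                                     (sym (x∙y⁻¹≈ε⇒x≈y _ _ (cong proj₁ eq)))
    in k , V³-≡ e₂ e₃ e₁
  ...     | yes r≡0 = contradiction (V³-≡ p≡0 q≡0 r≡0) n≢0

  -- Lagrange's identity (m × n) × w = (w · m) n - (w · n) m, whose coefficients are the multipliers
  -- below.
  orthogonal⇒cross-cross≡0 : ∀ m n w → dot w m ≡ 0# → dot w n ≡ 0# → cross (cross m n) w ≡ 0³
  orthogonal⇒cross-cross≡0 (a , b , c) (e , f , g) (u , v , w) w⊥m w⊥n = V³-≡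
    (linear₂ e (- a) w⊥m w⊥n (solve 9 (λ a b c e f g u v w →
      ((c :* e :- a :* g) :* w :- (a :* f :- b :* e) :* v) :- lit 0 :=
      e :* ((u :* a :+ v :* b :+ w :* c) :- lit 0) :+
      :- a :* ((u :* e :+ v :* f :+ w :* g) :- lit 0)) refl a b c e f g u v w))
    (linear₂ f (- b) w⊥m w⊥n (solve 9 (λ a b c e f g u v w →
      ((a :* f :- b :* e) :* u :- (b :* g :- c :* f) :* w) :- lit 0 :=
      f :* ((u :* a :+ v :* b :+ w :* c) :- lit 0) :+
      :- b :* ((u :* e :+ v :* f :+ w :* g) :- lit 0)) refl a b c e f g u v w))
    (linear₂ g (- c) w⊥m w⊥n (solve 9 (λ a b c e f g u v w →
      ((b :* g :- c :* f) :* v :- (c :* e :- a :* g) :* u) :- lit 0 :=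
      g :* ((u :* a :+ v :* b :+ w :* c) :- lit 0) :+
      :- c :* ((u :* e :+ v :* f :+ w :* g) :- lit 0)) refl a b c e f g u v w))

  -- Traceless matrices and lines on the quadric det = 1.

  -- (p, q, r) stands for the traceless matrix N = [[p, q], [r, -p]]; then
  -- norm N = - det N and ⟨ N , x ⟩ = tr (N x).

  norm : V³ → F
  norm (p , q , r) = p * p + q * r

  dual : M → V³
  dual (a , b , c , d) = a - d , c , b

  ⟨_,_⟩ : V³ → M → F
  ⟨ m , x ⟩ = dot m (dual x)

  -- The point with parameter k on the line through x in a traceless direction; all points of this
  -- line have the trace of x.
  translate : M → F → V³ → M
  translate (a , b , c , d) k (p , q , r) = a + k * p , b + k * q , c + k * r , d - k * p

  -- Three entries suffice because it is applied to matrices of equal trace, whose difference is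
  -- traceless.
  diff : M → M → V³
  diff (a , b , c , d) (e , f , g , h) = a - e , b - f , c - g

  translate-diff : ∀ x y → tr x ≡ tr y → x ≡ translate y 1# (diff x y)
  translate-diff (a , b , c , d) (e , f , g , h) tr≡ = M-≡
    (entry a e) (entry b f) (entry c g)
    (linear₁ 1# tr≡ (solve 4 (λ a d e h →
      d :- (h :- lit 1 :* (a :- e)) := lit 1 :* (a :+ d :- (e :+ h))) refl a d e h))
    where
    entry : ∀ a e → a ≡ e + 1# * (a - e)
    entry = solve 2 (λ a e → a := e :+ lit 1 :* (a :- e)) refl

  translate-0 : ∀ x m → translate x 0# m ≡ x
  translate-0 (a , b , c , d) (p , q , r) = M-≡ (e a p) (e b q) (e c r)
    (solve 2 (λ d p → d :- lit 0 :* p := d) refl d p)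
    where
    e : ∀ a p → a + 0# * p ≡ a
    e = solve 2 (λ a p → a :+ lit 0 :* p := a) refl

  translate-0³ : ∀ x k → translate x k 0³ ≡ x
  translate-0³ (a , b , c , d) k = M-≡ (e a) (e b) (e c)
    (solve 2 (λ d k → d :- k :* lit 0 := d) refl d k)
    where
    e : ∀ a → a + k * 0# ≡ a
    e a = solve 2 (λ a k → a :+ k :* lit 0 := a) refl a k

  translate-• : ∀ x k l m → translate x k (l •³ m) ≡ translate x (k * l) m
  translate-• (a , b , c , d) k l (p , q , r) = M-≡ (e a p) (e b q) (e c r)
    (cong (λ z → d - z) (sym (*-assoc k l p)))
    where
    e : ∀ a p → a + k * (l * p) ≡ a + k * l * p
    e a p = cong (a +_) (sym (*-assoc k l p))

  -- The adjugate is tr x · 1 - x, and scalar matrices pair to zero with traceless ones.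
  ⟨⟩-adj : ∀ m x → ⟨ m , adj x ⟩ ≡ - ⟨ m , x ⟩
  ⟨⟩-adj (p , q , r) (a , b , c , d) = solve 7 (λ a b c d p q r →
    p :* (d :- a) :+ q :* (:- c) :+ r :* (:- b) := :- (p :* (a :- d) :+ q :* c :+ r :* b))
    refl a b c d p q r

  ⟨⟩-adj≡0 : ∀ m x → ⟨ m , x ⟩ ≡ 0# → ⟨ m , adj x ⟩ ≡ 0#
  ⟨⟩-adj≡0 m x eq = trans (⟨⟩-adj m x) (trans (cong (-_) eq) (solve 0 (:- lit 0 := lit 0) refl))

  -- For traceless N the trace of N² is twice its norm, so moving along a null direction does not
  -- change the pairing with it.
  ⟨⟩-translate≡0 : ∀ m x k → norm m ≡ 0# → ⟨ m , x ⟩ ≡ 0# → ⟨ m , translate x k m ⟩ ≡ 0#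
  ⟨⟩-translate≡0 (p , q , r) (a , b , c , d) k norm≡0 ⟨⟩≡0 =
    linear₂ (k + k) 1# norm≡0 ⟨⟩≡0 (solve 8 (λ a b c d p q r k →
      p :* (a :+ k :* p :- (d :- k :* p)) :+ q :* (c :+ k :* r) :+ r :* (b :+ k :* q) :- lit 0 :=
      (k :+ k) :* (p :* p :+ q :* r :- lit 0) :+ lit 1 :* (p :* (a :- d) :+ q :* c :+ r :* b :- lit 0))
      refl a b c d p q r k)

  det-translate : ∀ x k m → det (translate x k m) ≡ det x - k * ⟨ m , x ⟩ - k * k * norm m
  det-translate (a , b , c , d) k (p , q , r) = solve 8 (λ a b c d p q r k →
    (a :+ k :* p) :* (d :- k :* p) :- (b :+ k :* q) :* (c :+ k :* r) :=
    a :* d :- b :* c :- k :* (p :* (a :- d) :+ q :* c :+ r :* b) :- k :* k :* (p :* p :+ q :* r))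
    refl a b c d p q r k

  -- A line meeting the quadric det = 1 in three points lies on it, and its
  -- direction is then nilpotent.
  line-in-quadric : ∀ x m k → k ≢ 0# → k ≢ 1# →
                    det x ≡ 1# → det (translate x 1# m) ≡ 1# → det (translate x k m) ≡ 1# →
                    norm m ≡ 0# × ⟨ m , x ⟩ ≡ 0#
  line-in-quadric x m k k≢0 k≢1 e₀ e₁ e₂ = norm≡0 , ⟨⟩≡0
    where
    eq₁ = trans (sym (det-translate x 1# m)) e₁
    eq₂ = trans (sym (det-translate x k m)) e₂
    k-1≢0 : k - 1# ≢ 0#
    k-1≢0 eq = k≢1 (x∙y⁻¹≈ε⇒x≈y _ _ eq)
    norm≡0 : norm m ≡ 0#
    -- The points at parameters 0, 1, k get the weights 1 - k, k, -1. This cancels the determinant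
    -- and the linear term and leaves k (k - 1) `norm m`.
    norm≡0 = *-cancelˡ-0 k-1≢0 (*-cancelˡ-0 k≢0 (linear₃ k (- 1#) (1# - k) eq₁ eq₂ e₀
      (solve 4 (λ D P N k →
        k :* ((k :- lit 1) :* N) :- lit 0 :=
        k :* (D :- lit 1 :* P :- lit 1 :* lit 1 :* N :- lit 1) :+
        :- lit 1 :* (D :- k :* P :- k :* k :* N :- lit 1) :+
        (lit 1 :- k) :* (D :- lit 1)) refl (det x) ⟨ m , x ⟩ (norm m) k)))
    ⟨⟩≡0 : ⟨ m , x ⟩ ≡ 0#
    ⟨⟩≡0 = linear₃ (- 1#) 1# (- 1#) eq₁ e₀ norm≡0 (solve 3 (λ D P N →
      P :- lit 0 :=
      :- lit 1 :* (D :- lit 1 :* P :- lit 1 :* lit 1 :* N :- lit 1) :+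
      lit 1 :* (D :- lit 1) :+ :- lit 1 :* (N :- lit 0)) refl (det x) ⟨ m , x ⟩ (norm m))

  -- The line is the kernel of m.
  kernel-line : ∀ m → m ≢ 0³ → norm m ≡ 0# → ∃ λ v → ∀ x → ⟨ m , x ⟩ ≡ 0# → Fixes v x
  kernel-line (p , q , r) m≢0 norm≡0 with q ≟ 0#
  ... | no q≢0 = just z , fixes
    where
    i = proj₁ (inverse q q≢0)
    -- The first row (p, q) of m kills (1, -p/q). As m is nonzero with square zero, its image is its
    -- kernel, and tr (m x) = 0 says that x preserves this line.
    z = - (p * i)
    fixes : ∀ x → ⟨ (p , q , r) , x ⟩ ≡ 0# → Fixes (just z) x
    fixes (a , b , c , d) ⟨⟩≡0 = a + b * z , V-≡
      (solve 3 (λ a b z → a :* lit 1 :+ b :* z := (a :+ b :* z) :* lit 1) refl a b z)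
      (linear₃ i (- (b * i * i)) (b * r * i - c) ⟨⟩≡0 norm≡0 (proj₂ (inverse q q≢0))
        (solve 8 (λ a b c d p q r i →
          c :* lit 1 :+ d :* :- (p :* i) :- (a :+ b :* :- (p :* i)) :* :- (p :* i) :=
          i :* (p :* (a :- d) :+ q :* c :+ r :* b :- lit 0) :+
          :- (b :* i :* i) :* (p :* p :+ q :* r :- lit 0) :+
          (b :* r :* i :- c) :* (q :* i :- lit 1)) refl a b c d p q r i))
  ... | yes refl = nothing , fixes
    where
    p≡0 : p ≡ 0#
    p≡0 = x*x≡0⇒x≡0 (trans (solve 2 (λ p r → p :* p := p :* p :+ lit 0 :* r) refl p r) norm≡0)
    r≢0 : r ≢ 0#
    r≢0 r≡0 = m≢0 (V³-≡ p≡0 refl r≡0)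
    fixes : ∀ x → ⟨ (p , 0# , r) , x ⟩ ≡ 0# → Fixes nothing x
    fixes (a , b , c , d) ⟨⟩≡0 = d , V-≡
      (trans (solve 3 (λ a b d → a :* lit 0 :+ b :* lit 1 := b) refl a b d)
        (trans b≡0 (sym (zeroʳ d))))
      (solve 2 (λ c d → c :* lit 0 :+ d :* lit 1 := d :* lit 1) refl c d)
      where
      b≡0 : b ≡ 0#
      b≡0 = *-cancelˡ-0 r≢0 (linear₂ 1# (- (a - d)) ⟨⟩≡0 p≡0 (solve 6 (λ a b c d p r →
        r :* b :- lit 0 := lit 1 :* (p :* (a :- d) :+ lit 0 :* c :+ r :* b :- lit 0) :+
        :- (a :- d) :* (p :- lit 0)) refl a b c d p r))

  -- Fibres of (x, y, z) ↦ (xy, xz).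

  -- For matrices of a fixed trace, tr (x⁻¹ a) is affine-linear in x, since the adjugates of x and
  -- x′ differ by x′ - x.
  diff-⊥ : ∀ x x′ a → tr x ≡ tr x′ → tr (adj x ⊗ᶠ a) ≡ tr (adj x′ ⊗ᶠ a) → ⟨ diff x′ x , a ⟩ ≡ 0#
  diff-⊥ (a , b , c , d) (a′ , b′ , c′ , d′) (e , f , g , h) tr≡ tr-adj≡ =
    linear₂ 1# (- e) tr-adj≡ tr≡ (solve 12 (λ a b c d a′ b′ c′ d′ e f g h →
      (a′ :- a) :* (e :- h) :+ (b′ :- b) :* g :+ (c′ :- c) :* f :- lit 0 :=
      lit 1 :* (d :* e :+ :- b :* g :+ (:- c :* f :+ a :* h) :-
                (d′ :* e :+ :- b′ :* g :+ (:- c′ :* f :+ a′ :* h))) :+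
      :- e :* (a :+ d :- (a′ :+ d′))) refl a b c d a′ b′ c′ d′ e f g h)

  affine : F → F → M → M
  affine k l (a , b , c , d) = k * a + l , k * b , k * c , k * d + l

  -- The kernel of `dual` consists of the scalar matrices, so b - k a is a scalar l, read off the
  -- lower right entry.
  dual-parallel⇒affine : ∀ a b k → dual b ≡ k •³ dual a → ∃ λ l → b ≡ affine k l a
  dual-parallel⇒affine (a , b , c , d) (e , f , g , h) k eq = h - k * d , M-≡
    (linear₁ 1# (cong proj₁ eq) (solve 5 (λ a d e h k →
      e :- (k :* a :+ (h :- k :* d)) := lit 1 :* (e :- h :- k :* (a :- d))) refl a d e h k))
    (cong (λ m → proj₂ (proj₂ m)) eq)
    (cong (λ m → proj₁ (proj₂ m)) eq)
    (solve 3 (λ d h k → h := k :* d :+ (h :- k :* d)) refl d h k)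

  -- Linearly dependent matrices of trace t are affinely dependent, as t ≠ 0.
  affine-⊗ : ∀ {t} u a k l → t ≢ 0# → tr u ≡ t → tr (u ⊗ᶠ a) ≡ t → tr (u ⊗ᶠ affine k l a) ≡ t →
             u ⊗ᶠ affine k l a ≡ translate u k (diff (u ⊗ᶠ a) u)
  affine-⊗ {t} u@(p , q , r , s) a@(e , f , g , h) k l t≢0 tr-u tr-ua tr-ub = M-≡
    (diagonal p q e g) (offdiagonal p q f h) (offdiagonal′ r s e g)
    (linear₃ k s (- k) tr-ua l≡1-k tr-u (solve 11 (λ p q r s e f g h k l t →
      r :* (k :* f) :+ s :* (k :* h :+ l) :- (s :- k :* (p :* e :+ q :* g :- p)) :=
      k :* (p :* e :+ q :* g :+ (r :* f :+ s :* h) :- t) :+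
      s :* (l :- (lit 1 :- k)) :+ :- k :* (p :+ s :- t)) refl p q r s e f g h k l t))
    where
    -- Taking traces in u b = k u a + l u gives t = (k + l) t, and t cancels.
    l≡1-k : l ≡ 1# - k
    l≡1-k = *-cancelˡ t≢0 (linear₃ 1# (- k) (- l) tr-ub tr-ua tr-u (solve 11 (λ p q r s e f g h k l t →
      t :* l :- t :* (lit 1 :- k) :=
      lit 1 :* (p :* (k :* e :+ l) :+ q :* (k :* g) :+ (r :* (k :* f) :+ s :* (k :* h :+ l)) :- t) :+
      :- k :* (p :* e :+ q :* g :+ (r :* f :+ s :* h) :- t) :+
      :- l :* (p :+ s :- t)) refl p q r s e f g h k l t))
    diagonal : ∀ p q e g → p * (k * e + l) + q * (k * g) ≡ p + k * (p * e + q * g - p)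
    diagonal p q e g = linear₁ p l≡1-k (solve 6 (λ p q e g k l →
      p :* (k :* e :+ l) :+ q :* (k :* g) :- (p :+ k :* (p :* e :+ q :* g :- p)) :=
      p :* (l :- (lit 1 :- k))) refl p q e g k l)
    offdiagonal : ∀ p q f h → p * (k * f) + q * (k * h + l) ≡ q + k * (p * f + q * h - q)
    offdiagonal p q f h = linear₁ q l≡1-k (solve 6 (λ p q f h k l →
      p :* (k :* f) :+ q :* (k :* h :+ l) :- (q :+ k :* (p :* f :+ q :* h :- q)) :=
      q :* (l :- (lit 1 :- k))) refl p q f h k l)
    offdiagonal′ : ∀ r s e g → r * (k * e + l) + s * (k * g) ≡ r + k * (r * e + s * g - r)
    offdiagonal′ = diagonal

  InClass : F → M → Set
  InClass t x = det x ≡ 1# × tr x ≡ t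

  tr-adj : ∀ x → tr (adj x) ≡ tr x
  tr-adj (a , b , c , d) = solve 2 (λ a d → d :+ a := a :+ d) refl a d

  det-adj : ∀ x → det (adj x) ≡ det x
  det-adj (a , b , c , d) = solve 4 (λ a b c d →
    d :* a :- :- b :* :- c := a :* d :- b :* c) refl a b c d

  InClass-adj : ∀ {t} x → InClass t x → InClass t (adj x)
  InClass-adj x (det≡1 , tr≡t) = trans (det-adj x) det≡1 , trans (tr-adj x) tr≡t

  collinear⇒common-line : ∀ {u m k} → m ≢ 0³ → k ≢ 0# → k ≢ 1# →
    det u ≡ 1# → det (translate u 1# m) ≡ 1# → det (translate u k m) ≡ 1# →
    norm m ≡ 0# × ⟨ m , u ⟩ ≡ 0# × ∃ λ v → ∀ y → ⟨ m , y ⟩ ≡ 0# → Fixes v y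
  collinear⇒common-line {u} {m} {k} m≢0 k≢0 k≢1 e₀ e₁ e₂ =
    let norm≡0 , ⟨⟩≡0 = line-in-quadric u m k k≢0 k≢1 e₀ e₁ e₂
    in norm≡0 , ⟨⟩≡0 , kernel-line m m≢0 norm≡0

  -- If `dual a` were zero, a would be a scalar, and comparing the nonzero traces of u and u a would
  -- make it 1. This is `affine-⊗` with k = 0.
  dual≢0 : ∀ {t u a} → t ≢ 0# → tr u ≡ t → tr (u ⊗ᶠ a) ≡ t → u ⊗ᶠ a ≢ u → dual a ≢ 0³
  dual≢0 {t} {u} {a} t≢0 tr-u tr-ua ua≢u dual≡0 = ua≢u (trans (cong (u ⊗ᶠ_) a≡)
    (trans (affine-⊗ u a 0# l t≢0 tr-u tr-ua (trans (cong (λ b → tr (u ⊗ᶠ b)) (sym a≡)) tr-ua))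
           (translate-0 u _)))
    where
    0•³ : ∀ m → 0³ ≡ 0# •³ m
    0•³ (p , q , r) = V³-≡ (sym (zeroˡ p)) (sym (zeroˡ q)) (sym (zeroˡ r))
    l = proj₁ (dual-parallel⇒affine a a 0# (trans dual≡0 (0•³ (dual a))))
    a≡ : a ≡ affine 0# l a
    a≡ = proj₂ (dual-parallel⇒affine a a 0# (trans dual≡0 (0•³ (dual a))))

  -- By `affine-⊗` the points u, u a, u b lie on one line at parameters 0, 1, k. As they are
  -- distinct, the line lies on the quadric, and its null direction m pairs to zero with all three.
  dependent⇒common-line : ∀ {t k} u a b → t ≢ 0# →
    InClass t u → InClass t (u ⊗ᶠ a) → InClass t (u ⊗ᶠ b) →
    u ⊗ᶠ a ≢ u → u ⊗ᶠ b ≢ u → u ⊗ᶠ a ≢ u ⊗ᶠ b → dual b ≡ k •³ dual a →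
    ∃ λ v → Fixes v (adj u) × Fixes v (u ⊗ᶠ a) × Fixes v (u ⊗ᶠ b)
  dependent⇒common-line {t} {k} u a b t≢0 (det-u , tr-u) (det-y , tr-y) (det-z , tr-z) y≢u z≢u y≢z eq
    with dual-parallel⇒affine a b k eq
  ... | l , refl = v , fixes (adj u) (⟨⟩-adj≡0 m u ⟨⟩≡0) , fixes y ⟨m,y⟩≡0 , fixes z ⟨m,z⟩≡0
    where
    y = u ⊗ᶠ a
    z = u ⊗ᶠ b
    m = diff y u
    y≡ : y ≡ translate u 1# m
    y≡ = translate-diff y u (trans tr-y (sym tr-u))
    z≡ : z ≡ translate u k m
    z≡ = affine-⊗ u a k l t≢0 tr-u tr-y tr-z
    m≢0 : m ≢ 0³
    m≢0 m≡0 = y≢u (trans y≡ (trans (cong (translate u 1#) m≡0) (translate-0³ u 1#)))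
    k≢0 : k ≢ 0#
    k≢0 k≡0 = z≢u (trans z≡ (trans (cong (λ k → translate u k m) k≡0) (translate-0 u m)))
    k≢1 : k ≢ 1#
    k≢1 k≡1 = y≢z (trans y≡ (sym (trans z≡ (cong (λ k → translate u k m) k≡1))))
    line = collinear⇒common-line m≢0 k≢0 k≢1 det-u
      (trans (cong det (sym y≡)) det-y) (trans (cong det (sym z≡)) det-z)
    norm≡0 = proj₁ line
    ⟨⟩≡0 = proj₁ (proj₂ line)
    v = proj₁ (proj₂ (proj₂ line))
    fixes = proj₂ (proj₂ (proj₂ line))
    ⟨m,y⟩≡0 : ⟨ m , y ⟩ ≡ 0#
    ⟨m,y⟩≡0 = trans (cong ⟨ m ,_⟩ y≡) (⟨⟩-translate≡0 m u 1# norm≡0 ⟨⟩≡0)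
    ⟨m,z⟩≡0 : ⟨ m , z ⟩ ≡ 0#
    ⟨m,z⟩≡0 = trans (cong ⟨ m ,_⟩ z≡) (⟨⟩-translate≡0 m u k norm≡0 ⟨⟩≡0)

  -- The differences x′ - x and x″ - x are orthogonal to a and b, hence multiples of the cross
  -- product n, and the three points are collinear. The resulting line is fixed by x, a and b,
  -- therefore also by x⁻¹a and x⁻¹b.
  independent⇒common-line : ∀ {t} a b x x′ x″ →
    InClass t x → InClass t x′ → InClass t x″ →
    (∀ {c} → c ≡ a ⊎ c ≡ b → tr (adj x ⊗ᶠ c) ≡ t × tr (adj x′ ⊗ᶠ c) ≡ t × tr (adj x″ ⊗ᶠ c) ≡ t) →
    x ≢ x′ → x ≢ x″ → x′ ≢ x″ → cross (dual a) (dual b) ≢ 0³ →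
    ∃ λ v → Fixes v x × Fixes v (adj x ⊗ᶠ a) × Fixes v (adj x ⊗ᶠ b)
  independent⇒common-line {t} a b x x′ x″ (det-x , tr-x) (det-x′ , tr-x′) (det-x″ , tr-x″)
    trs x≢x′ x≢x″ x′≢x″ n≢0 =
      v , fixes x ⟨w,x⟩≡0 , Fixes-⊗ v fixes-adj (fixes a (w⊥ (inj₁ refl)))
                          , Fixes-⊗ v fixes-adj (fixes b (w⊥ (inj₂ refl)))
    where
    n = cross (dual a) (dual b)
    w = diff x′ x
    w″ = diff x″ x
    w⊥ : ∀ {c} → c ≡ a ⊎ c ≡ b → ⟨ w , c ⟩ ≡ 0#
    w⊥ {c} i = let e , e′ , _ = trs i in
      diff-⊥ x x′ c (trans tr-x (sym tr-x′)) (trans e (sym e′))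
    w″⊥ : ∀ {c} → c ≡ a ⊎ c ≡ b → ⟨ w″ , c ⟩ ≡ 0#
    w″⊥ {c} i = let e , _ , e″ = trs i in
      diff-⊥ x x″ c (trans tr-x (sym tr-x″)) (trans e (sym e″))
    ∥n : ∀ {w} → (∀ {c} → c ≡ a ⊎ c ≡ b → ⟨ w , c ⟩ ≡ 0#) → ∃ λ k → w ≡ k •³ n
    ∥n {w} ⊥ab = cross≡0⇒parallel n≢0
      (orthogonal⇒cross-cross≡0 (dual a) (dual b) w (⊥ab (inj₁ refl)) (⊥ab (inj₂ refl)))
    s = proj₁ (∥n w⊥)
    s″ = proj₁ (∥n w″⊥)
    x′≡ : x′ ≡ translate x s n
    x′≡ = trans (translate-diff x′ x (trans tr-x′ (sym tr-x)))
      (trans (cong (translate x 1#) (proj₂ (∥n w⊥)))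
      (trans (translate-• x 1# s n) (cong (λ k → translate x k n) (*-identityˡ s))))
    x″≡ : x″ ≡ translate x s″ n
    x″≡ = trans (translate-diff x″ x (trans tr-x″ (sym tr-x)))
      (trans (cong (translate x 1#) (proj₂ (∥n w″⊥)))
      (trans (translate-• x 1# s″ n) (cong (λ k → translate x k n) (*-identityˡ s″))))
    s≢0 : s ≢ 0#
    s≢0 s≡0 = x≢x′ (sym (trans x′≡ (trans (cong (λ k → translate x k n) s≡0) (translate-0 x n))))
    s″≢0 : s″ ≢ 0#
    s″≢0 s″≡0 = x≢x″ (sym (trans x″≡ (trans (cong (λ k → translate x k n) s″≡0) (translate-0 x n))))
    i = proj₁ (inverse s s≢0)
    -- Measured in the direction w = x′ - x instead of n, the three points have parameters 0, 1 and
    -- s″/s.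
    k = s″ * i
    ks≡s″ : k * s ≡ s″
    ks≡s″ = linear₁ s″ (proj₂ (inverse s s≢0)) (solve 3 (λ s s″ i →
      s″ :* i :* s :- s″ := s″ :* (s :* i :- lit 1)) refl s s″ i)
    x″≡′ : x″ ≡ translate x k w
    x″≡′ = trans x″≡ (trans (cong (λ l → translate x l n) (sym ks≡s″))
      (trans (sym (translate-• x k s n)) (cong (translate x k) (sym (proj₂ (∥n w⊥))))))
    x′≡′ : x′ ≡ translate x 1# w
    x′≡′ = translate-diff x′ x (trans tr-x′ (sym tr-x))
    k≢0 : k ≢ 0#
    k≢0 k≡0 = s″≢0 (trans (sym ks≡s″) (trans (cong (_* s) k≡0) (zeroˡ s)))
    k≢1 : k ≢ 1#
    k≢1 k≡1 = x′≢x″ (trans x′≡′ (sym (trans x″≡′ (cong (λ k → translate x k w) k≡1))))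
    w≢0 : w ≢ 0³
    w≢0 w≡0 = x≢x′ (sym (trans x′≡′ (trans (cong (translate x 1#) w≡0) (translate-0³ x 1#))))
    line = collinear⇒common-line w≢0 k≢0 k≢1 det-x
      (trans (cong det (sym x′≡′)) det-x′) (trans (cong det (sym x″≡′)) det-x″)
    ⟨w,x⟩≡0 = proj₁ (proj₂ line)
    v = proj₁ (proj₂ (proj₂ line))
    fixes = proj₂ (proj₂ (proj₂ line))
    fixes-adj : Fixes v (adj x)
    fixes-adj = fixes (adj x) (⟨⟩-adj≡0 w x ⟨w,x⟩≡0)

  fibre⇒common-line : ∀ {t} x y z x′ y′ z′ x″ y″ z″ → t ≢ 0# →
    InClass t x → InClass t y → InClass t z →
    InClass t x′ → InClass t y′ → InClass t z′ →
    InClass t x″ → InClass t y″ → InClass t z″ →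
    x′ ⊗ᶠ y′ ≡ x ⊗ᶠ y → x′ ⊗ᶠ z′ ≡ x ⊗ᶠ z → x″ ⊗ᶠ y″ ≡ x ⊗ᶠ y → x″ ⊗ᶠ z″ ≡ x ⊗ᶠ z →
    y ≢ adj x → z ≢ adj x → y ≢ z → x ≢ x′ → x ≢ x″ → x′ ≢ x″ →
    ∃ λ v → Fixes v x × Fixes v y × Fixes v z
  fibre⇒common-line {t} x y z x′ y′ z′ x″ y″ z″ t≢0 cx cy cz cx′ cy′ cz′ cx″ cy″ cz″
    x′y′ x′z′ x″y″ x″z″ y≢u z≢u y≢z x≢x′ x≢x″ x′≢x″ = conclude
    where
    a = x ⊗ᶠ y
    b = x ⊗ᶠ z
    u = adj x
    ua≡y : u ⊗ᶠ a ≡ y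
    ua≡y = adj-⊗ x y (proj₁ cx)
    ub≡z : u ⊗ᶠ b ≡ z
    ub≡z = adj-⊗ x z (proj₁ cx)
    tr-u⊗ : ∀ {x y c} → InClass t x → InClass t y → x ⊗ᶠ y ≡ c → tr (adj x ⊗ᶠ c) ≡ t
    tr-u⊗ {x} {y} (det≡1 , _) (_ , tr≡t) refl = trans (cong tr (adj-⊗ x y det≡1)) tr≡t
    trs : ∀ {c} → c ≡ a ⊎ c ≡ b → tr (adj x ⊗ᶠ c) ≡ t × tr (adj x′ ⊗ᶠ c) ≡ t × tr (adj x″ ⊗ᶠ c) ≡ t
    trs (inj₁ refl) = tr-u⊗ cx cy refl , tr-u⊗ cx′ cy′ x′y′ , tr-u⊗ cx″ cy″ x″y″
    trs (inj₂ refl) = tr-u⊗ cx cz refl , tr-u⊗ cx′ cz′ x′z′ , tr-u⊗ cx″ cz″ x″z″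
    ua≢u : u ⊗ᶠ a ≢ u
    ua≢u eq = y≢u (trans (sym ua≡y) eq)
    adj-adj : adj u ≡ x
    adj-adj = M-≡ refl (-‿involutive _) (-‿involutive _) refl
    conclude : ∃ λ v → Fixes v x × Fixes v y × Fixes v z
    conclude with cross (dual a) (dual b) ≟³ 0³
    -- Here 1, a, b are linearly dependent, and the collinear points are x⁻¹, y, z.
    ... | yes n≡0 =
      let k , dual-b = cross≡0⇒parallel (dual≢0 {u = u} {a} t≢0 (proj₂ (InClass-adj x cx)) (proj₁ (trs (inj₁ refl))) ua≢u) n≡0
          v , fx , fy , fz = dependent⇒common-line u a b t≢0 (InClass-adj x cx)
            (subst (InClass t) (sym ua≡y) cy) (subst (InClass t) (sym ub≡z) cz)
            ua≢u (λ eq → z≢u (trans (sym ub≡z) eq))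
            (λ eq → y≢z (trans (sym ua≡y) (trans eq ub≡z))) dual-b
      in v , subst (Fixes v) adj-adj fx , subst (Fixes v) ua≡y fy , subst (Fixes v) ub≡z fz
    -- Here the collinear points are the first components x, x′, x″ of the fibre.
    ... | no n≢0 =
      let v , fx , fy , fz = independent⇒common-line a b x x′ x″ cx cx′ cx″ trs x≢x′ x≢x″ x′≢x″ n≢0
      in v , fx , subst (Fixes v) ua≡y fy , subst (Fixes v) ub≡z fz

-- Cardinality bounds for predicates.

module Counting where
  open ≡ using (refl; sym; trans; cong; cong₂)

  private variable
    a b c q r : Level
    A : Set a
    B : Set b
    P : Pred A q
    Q : Pred A r

  -- Quantifying over duplicate-free lists bounds the size of P without deciding P or enumerating
  -- it.
  Bounded : {A : Set a} → Pred A q → ℕ → Set _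
  Bounded P n = ∀ xs → Unique xs → All P xs → length xs ℕ.≤ n

  Unique-resp-⊆ : {xs ys : List A} → xs ⊆ ys → Unique ys → Unique xs
  Unique-resp-⊆ []          []       = []
  Unique-resp-⊆ (_ ∷ʳ τ)    (_ ∷ u)  = Unique-resp-⊆ τ u
  Unique-resp-⊆ (refl ∷ τ)  (x∉ ∷ u) = All-resp-⊆ τ x∉ ∷ Unique-resp-⊆ τ u

  partition-∪ : (xs : List A) → All (P ∪ Q) xs → ∃₂ λ ys zs →
                ys ⊆ xs × zs ⊆ xs × All P ys × All Q zs × length xs ≡ length ys ℕ.+ length zs
  partition-∪ []       []       = [] , [] , [] , [] , [] , [] , refl
  partition-∪ (x ∷ xs) (d ∷ ds) with partition-∪ xs ds | d
  ... | ys , zs , τ , σ , ps , qs , eq | inj₁ p =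
    x ∷ ys , zs , refl ∷ τ , x ∷ʳ σ , p ∷ ps , qs , cong suc eq
  ... | ys , zs , τ , σ , ps , qs , eq | inj₂ q =
    ys , x ∷ zs , x ∷ʳ τ , refl ∷ σ , ps , q ∷ qs , trans (cong suc eq) (sym (ℕ.+-suc _ _))

  Bounded-∪ : ∀ {m n} → Bounded P m → Bounded Q n → Bounded (P ∪ Q) (m ℕ.+ n)
  Bounded-∪ {m = m} {n} bP bQ xs u ds with partition-∪ xs ds
  ... | ys , zs , τ , σ , ps , qs , eq = begin
    length xs                ≡⟨ eq ⟩
    length ys ℕ.+ length zs  ≤⟨ ℕ.+-mono-≤ (bP ys (Unique-resp-⊆ τ u) ps) (bQ zs (Unique-resp-⊆ σ u) qs) ⟩
    m ℕ.+ n                  ∎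
    where open ℕ.≤-Reasoning

  Bounded-mono : ∀ {n} → (∀ {x} → P x → Q x) → Bounded Q n → Bounded P n
  Bounded-mono P⇒Q bQ xs u ps = bQ xs u (All.map P⇒Q ps)

  Bounded-Any′ : {R : B → Pred A r} {k : ℕ} → (∀ b → Bounded (R b) k) →
                 ∀ ys → Bounded (λ x → Any (λ b → R b x) ys) (length ys ℕ.* k)
  Bounded-Any′ bR []       []      _ _       = ℕ.z≤n
  Bounded-Any′ bR []       (_ ∷ _) _ (() ∷ _)
  Bounded-Any′ bR (y ∷ ys) = Bounded-mono Any.toSum (Bounded-∪ (bR y) (Bounded-Any′ bR ys))

  Bounded-Any : {R : B → Pred A r} {m k : ℕ} (ys : List B) → length ys ℕ.≤ m →
                (∀ b → Bounded (R b) k) → Bounded (λ x → Any (λ b → R b x) ys) (m ℕ.* k)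
  Bounded-Any {k = k} ys ys≤m bR xs u ps =
    ℕ.≤-trans (Bounded-Any′ bR ys xs u ps) (ℕ.*-monoˡ-≤ k ys≤m)

  Bounded-1 : (∀ {x y} → P x → P y → x ≡ y) → Bounded P 1
  Bounded-1 f []          _                  _            = ℕ.z≤n
  Bounded-1 f (_ ∷ [])    _                  _            = ℕ.≤-refl
  Bounded-1 f (x ∷ y ∷ _) ((x≢y ∷ _) ∷ _)    (px ∷ py ∷ _) = contradiction (f px py) x≢y

  -- The doubly negated conclusion lets a caller assume three distinct elements and derive a
  -- contradiction.
  Bounded-2 : (∀ {x y z} → P x → P y → P z → x ≢ y → x ≢ z → ¬ (y ≢ z)) → Bounded P 2
  Bounded-2 f []              _ _ = ℕ.z≤n
  Bounded-2 f (_ ∷ [])        _ _ = ℕ.s≤s ℕ.z≤n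
  Bounded-2 f (_ ∷ _ ∷ [])    _ _ = ℕ.≤-refl
  Bounded-2 f (x ∷ y ∷ z ∷ _) ((x≢y ∷ x≢z ∷ _) ∷ (y≢z ∷ _) ∷ _) (px ∷ py ∷ pz ∷ _) =
    contradiction y≢z (f px py pz x≢y x≢z)

  length-cartesianProduct : (xs : List A) (ys : List B) →
                            length (cartesianProduct xs ys) ≡ length xs ℕ.* length ys
  length-cartesianProduct []       ys = refl
  length-cartesianProduct (x ∷ xs) ys = trans (length-++ (map (x ,_) ys))
    (cong₂ ℕ._+_ (length-map (x ,_) ys) (length-cartesianProduct xs ys))

  -- Counting by fibres over pairs from `ys` and `zs`. As `R` is a relation, a code may carry
  -- further data, such as a choice of eigenvalues.
  Bounded-coded : {C : Set c} {R : B → C → Pred A r} {k : ℕ} (ys : List B) (zs : List C) →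
                  (∀ {x} → P x → ∃₂ λ y z → y ∈ ys × z ∈ zs × R y z x) →
                  (∀ y z → Bounded (R y z) k) → Bounded P (length ys ℕ.* (length zs ℕ.* k))
  Bounded-coded ys zs code bR =
    Bounded-mono (λ px → let y , z , y∈ys , z∈zs , r = code px in lose y∈ys (lose z∈zs r))
      (Bounded-Any ys ℕ.≤-refl (λ y → Bounded-Any zs ℕ.≤-refl (bR y)))

-- The field of p elements.

module PrimeField (p : ℕ) {{p≢0 : NonZero p}} (p-prime : Prime p) where
  open ≡ using (refl; sym; trans; cong; cong₂)
  open ≡.≡-Reasoning

  _+ᵖ_ _*ᵖ_ : Op₂ (Fin p)
  x +ᵖ y = (toℕ x ℕ.+ toℕ y) mod p
  x *ᵖ y = (toℕ x ℕ.* toℕ y) mod p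

  0ᵖ 1ᵖ : Fin p
  0ᵖ = 0 mod p
  1ᵖ = 1 mod p

  toℕ-mod : ∀ m → toℕ (m mod p) ≡ m % p
  toℕ-mod m = toℕ-fromℕ< (m%n<n m p)

  mod-toℕ : ∀ x → toℕ x mod p ≡ x
  mod-toℕ x = toℕ-injective (trans (toℕ-mod (toℕ x)) (m<n⇒m%n≡m (toℕ<n x)))

  mod-cong : ∀ {m n} → m % p ≡ n % p → m mod p ≡ n mod p
  mod-cong {m} {n} eq = toℕ-injective (trans (toℕ-mod m) (trans eq (sym (toℕ-mod n))))

  mod-injective : ∀ {m n} → m mod p ≡ n mod p → m % p ≡ n % p
  mod-injective {m} {n} eq = trans (sym (toℕ-mod m)) (trans (cong toℕ eq) (toℕ-mod n))

  mod-+ : ∀ m n → (m ℕ.+ n) mod p ≡ (m mod p) +ᵖ (n mod p)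
  mod-+ m n = trans (mod-cong (%-distribˡ-+ m n p))
    (cong (_mod p) (cong₂ ℕ._+_ (sym (toℕ-mod m)) (sym (toℕ-mod n))))

  mod-* : ∀ m n → (m ℕ.* n) mod p ≡ (m mod p) *ᵖ (n mod p)
  mod-* m n = trans (mod-cong (%-distribˡ-* m n p))
    (cong (_mod p) (cong₂ ℕ._*_ (sym (toℕ-mod m)) (sym (toℕ-mod n))))

  -- Removing the inner reduction turns the ring laws modulo p into laws of ℕ.
  +ᵖ-modˡ : ∀ m x → (m mod p) +ᵖ x ≡ (m ℕ.+ toℕ x) mod p
  +ᵖ-modˡ m x = sym (trans (mod-+ m (toℕ x)) (cong ((m mod p) +ᵖ_) (mod-toℕ x)))

  *ᵖ-modˡ : ∀ m x → (m mod p) *ᵖ x ≡ (m ℕ.* toℕ x) mod p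
  *ᵖ-modˡ m x = sym (trans (mod-* m (toℕ x)) (cong ((m mod p) *ᵖ_) (mod-toℕ x)))

  +ᵖ-comm : ∀ x y → x +ᵖ y ≡ y +ᵖ x
  +ᵖ-comm x y = cong (_mod p) (ℕ.+-comm (toℕ x) (toℕ y))

  *ᵖ-comm : ∀ x y → x *ᵖ y ≡ y *ᵖ x
  *ᵖ-comm x y = cong (_mod p) (ℕ.*-comm (toℕ x) (toℕ y))

  +ᵖ-assoc : ∀ x y z → (x +ᵖ y) +ᵖ z ≡ x +ᵖ (y +ᵖ z)
  +ᵖ-assoc x y z = begin
    (x +ᵖ y) +ᵖ z                         ≡⟨ +ᵖ-modˡ _ z ⟩
    (toℕ x ℕ.+ toℕ y ℕ.+ toℕ z) mod p     ≡⟨ cong (_mod p) (rearrange (toℕ x) (toℕ y) (toℕ z)) ⟩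
    (toℕ y ℕ.+ toℕ z ℕ.+ toℕ x) mod p     ≡⟨ +ᵖ-modˡ _ x ⟨
    (y +ᵖ z) +ᵖ x                         ≡⟨ +ᵖ-comm _ x ⟩
    x +ᵖ (y +ᵖ z)                         ∎
    where
    rearrange : ∀ k m n → k ℕ.+ m ℕ.+ n ≡ m ℕ.+ n ℕ.+ k
    rearrange = solve-∀

  *ᵖ-assoc : ∀ x y z → (x *ᵖ y) *ᵖ z ≡ x *ᵖ (y *ᵖ z)
  *ᵖ-assoc x y z = begin
    (x *ᵖ y) *ᵖ z                         ≡⟨ *ᵖ-modˡ _ z ⟩
    (toℕ x ℕ.* toℕ y ℕ.* toℕ z) mod p     ≡⟨ cong (_mod p) (rearrange (toℕ x) (toℕ y) (toℕ z)) ⟩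
    (toℕ y ℕ.* toℕ z ℕ.* toℕ x) mod p     ≡⟨ *ᵖ-modˡ _ x ⟨
    (y *ᵖ z) *ᵖ x                         ≡⟨ *ᵖ-comm _ x ⟩
    x *ᵖ (y *ᵖ z)                         ∎
    where
    rearrange : ∀ k m n → k ℕ.* m ℕ.* n ≡ m ℕ.* n ℕ.* k
    rearrange = solve-∀

  *ᵖ-distribʳ : ∀ x y z → (y +ᵖ z) *ᵖ x ≡ (y *ᵖ x) +ᵖ (z *ᵖ x)
  *ᵖ-distribʳ x y z = begin
    (y +ᵖ z) *ᵖ x                                     ≡⟨ *ᵖ-modˡ _ x ⟩
    ((toℕ y ℕ.+ toℕ z) ℕ.* toℕ x) mod p               ≡⟨ cong (_mod p) (ℕ.*-distribʳ-+ (toℕ x) (toℕ y) (toℕ z)) ⟩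
    (toℕ y ℕ.* toℕ x ℕ.+ toℕ z ℕ.* toℕ x) mod p       ≡⟨ mod-+ _ _ ⟩
    (y *ᵖ x) +ᵖ (z *ᵖ x)                              ∎

  +ᵖ-identityˡ : ∀ x → 0ᵖ +ᵖ x ≡ x
  +ᵖ-identityˡ x = trans (+ᵖ-modˡ 0 x) (mod-toℕ x)

  *ᵖ-identityˡ : ∀ x → 1ᵖ *ᵖ x ≡ x
  *ᵖ-identityˡ x = trans (*ᵖ-modˡ 1 x) (trans (cong (_mod p) (ℕ.*-identityˡ (toℕ x))) (mod-toℕ x))

  negᵖ-inverseˡ : ∀ x → neg p x +ᵖ x ≡ 0ᵖ
  negᵖ-inverseˡ x = trans (+ᵖ-modˡ (p ∸ toℕ x) x)
    (trans (cong (_mod p) (ℕ.m∸n+n≡m (ℕ.<⇒≤ (toℕ<n x)))) (mod-cong (trans (n%n≡0 p) (sym (m*n%n≡0 0 p)))))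

  isCommutativeRing : IsCommutativeRing _≡_ _+ᵖ_ _*ᵖ_ (neg p) 0ᵖ 1ᵖ
  isCommutativeRing = record
    { isRing = record
      { +-isAbelianGroup = record
        { isGroup = record
          { isMonoid = record
            { isSemigroup = record
              { isMagma = ≡.isMagma _+ᵖ_
              ; assoc = +ᵖ-assoc }
            ; identity = comm∧idˡ⇒id +ᵖ-comm +ᵖ-identityˡ }
          ; inverse = comm∧invˡ⇒inv +ᵖ-comm negᵖ-inverseˡ
          ; ⁻¹-cong = cong (neg p) }
        ; comm = +ᵖ-comm }
      ; *-cong = cong₂ _*ᵖ_
      ; *-assoc = *ᵖ-assoc
      ; *-identity = comm∧idˡ⇒id *ᵖ-comm *ᵖ-identityˡ
      ; distrib = comm∧distrʳ⇒distrˡ *ᵖ-comm *ᵖ-distribʳ , *ᵖ-distribʳ }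
    ; *-comm = *ᵖ-comm }

  commutativeRing : CommutativeRing _ _
  commutativeRing = record { isCommutativeRing = isCommutativeRing }

  open CommutativeRing commutativeRing using (ring; +-group)
  open import Algebra.Properties.Ring ring using (-‿distribʳ-*)
  open import Algebra.Properties.Group +-group using (inverseˡ-unique)

  inverseᵖ : ∀ x → x ≢ 0ᵖ → ∃ λ y → x *ᵖ y ≡ 1ᵖ
  inverseᵖ x x≢0 with coprime-Bézout (prime⇒coprime p-prime {{ℕ.≢-nonZero toℕx≢0}} (toℕ<n x))
    where
    toℕx≢0 : toℕ x ≢ 0
    toℕx≢0 eq = x≢0 (trans (sym (mod-toℕ x)) (cong (_mod p) eq))
  -- Bézout for p and x has two sign patterns: 1 + a p = b x makes b the inverse, and 1 + b x = a p
  -- makes it -b.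
  ... | Bézout.-+ a b eq = b mod p , (begin
    x *ᵖ (b mod p)          ≡⟨ *ᵖ-comm x _ ⟩
    (b mod p) *ᵖ x          ≡⟨ *ᵖ-modˡ b x ⟩
    (b ℕ.* toℕ x) mod p     ≡⟨ cong (_mod p) eq ⟨
    (1 ℕ.+ a ℕ.* p) mod p   ≡⟨ mod-cong ([m+kn]%n≡m%n 1 a p) ⟩
    1ᵖ                      ∎)
  ... | Bézout.+- a b eq = neg p (b mod p) , (begin
    x *ᵖ neg p (b mod p)    ≡⟨ -‿distribʳ-* x _ ⟨
    neg p (x *ᵖ (b mod p))  ≡⟨ cong (neg p) (*ᵖ-comm x _) ⟩
    neg p ((b mod p) *ᵖ x)  ≡⟨ inverseˡ-unique 1ᵖ _ 1+bx≡0 ⟨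
    1ᵖ                      ∎)
    where
    1+bx≡0 : 1ᵖ +ᵖ ((b mod p) *ᵖ x) ≡ 0ᵖ
    1+bx≡0 = begin
      1ᵖ +ᵖ ((b mod p) *ᵖ x)             ≡⟨ cong (1ᵖ +ᵖ_) (*ᵖ-modˡ b x) ⟩
      1ᵖ +ᵖ ((b ℕ.* toℕ x) mod p)        ≡⟨ mod-+ 1 (b ℕ.* toℕ x) ⟨
      (1 ℕ.+ b ℕ.* toℕ x) mod p          ≡⟨ cong (_mod p) eq ⟩
      (a ℕ.* p) mod p                    ≡⟨ mod-cong (trans (m*n%n≡0 a p) (sym (m*n%n≡0 0 p))) ⟩
      0ᵖ                                 ∎

  1ᵖ≢0ᵖ : 1ᵖ ≢ 0ᵖ
  1ᵖ≢0ᵖ eq with trans (sym (m<n⇒m%n≡m (ℕ.nonTrivial⇒n>1 p {{prime⇒nonTrivial p-prime}})))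
                      (trans (mod-injective eq) (m*n%n≡0 0 p))
  ... | ()

  𝔽ₚ : DecidableField
  𝔽ₚ = record
    { isCommutativeRing = isCommutativeRing
    ; _≟_               = Fin._≟_
    ; inverse           = inverseᵖ
    ; 1≢0               = 1ᵖ≢0ᵖ
    }

-- Traces of conjugates over a field of characteristic p.

module Characteristic {c ℓ} (K : AlgClosedField c ℓ) (p : ℕ) {{_ : NonZero p}} (p-prime : Prime p)
                      (p≈0 : HasChar K p) where
  open AlgClosedField K
  open CommutativeRing cring
  open IntegerCoefficients cring using (solve; _:=_; _:+_; _:*_; _:-_; :-_)
  open import Algebra.Properties.Group +-group using (∙-cancelˡ)
  open import Relation.Binary.Reasoning.Setoid setoid

  natK-+ : ∀ m n → natK cring (m ℕ.+ n) ≈ natK cring m + natK cring n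
  natK-+ zero    n = sym (+-identityˡ _)
  natK-+ (suc m) n = trans (+-congˡ (natK-+ m n)) (sym (+-assoc _ _ _))

  natK-* : ∀ m n → natK cring (m ℕ.* n) ≈ natK cring m * natK cring n
  natK-* zero    n = sym (zeroˡ _)
  natK-* (suc m) n = trans (natK-+ n (m ℕ.* n))
    (trans (+-cong (sym (*-identityˡ _)) (natK-* m n)) (sym (distribʳ _ _ _)))

  natK-multiple : ∀ m {n} → natK cring n ≈ 0# → natK cring (m ℕ.* n) ≈ 0#
  natK-multiple m n≈0 = trans (natK-* m _) (trans (*-congˡ n≈0) (zeroʳ _))

  natK-% : ∀ m → natK cring m ≈ natK cring (m % p)
  natK-% m = begin
    natK cring m                                          ≡⟨ ≡.cong (natK cring) (m≡m%n+[m/n]*n m p) ⟩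
    natK cring (m % p ℕ.+ m / p ℕ.* p)                    ≈⟨ natK-+ (m % p) (m / p ℕ.* p) ⟩
    natK cring (m % p) + natK cring (m / p ℕ.* p)         ≈⟨ +-congˡ (natK-multiple (m / p) p≈0) ⟩
    natK cring (m % p) + 0#                               ≈⟨ +-identityʳ _ ⟩
    natK cring (m % p)                                    ∎

  bezout≉ : ∀ a b {m n} → 1 ℕ.+ b ℕ.* n ≡ a ℕ.* m → natK cring m ≈ 0# → ¬ (natK cring n ≈ 0#)
  bezout≉ a b {m} {n} eq m≈0 n≈0 = nontrivial (begin
    1#                             ≈⟨ +-identityʳ 1# ⟨
    1# + 0#                        ≈⟨ +-congˡ (natK-multiple b n≈0) ⟨
    natK cring (1 ℕ.+ b ℕ.* n)     ≡⟨ ≡.cong (natK cring) eq ⟩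
    natK cring (a ℕ.* m)           ≈⟨ natK-multiple a m≈0 ⟩
    0#                             ∎)

  -- Such a d is coprime to p, so if it vanished in K along with p, Bézout would make 1 vanish.
  natK-≉0 : ∀ d → d ≢ 0 → d ℕ.< p → ¬ (natK cring d ≈ 0#)
  natK-≉0 d d≢0 d<p d≈0 with coprime-Bézout (prime⇒coprime p-prime {{ℕ.≢-nonZero d≢0}} d<p)
  ... | Bézout.+- a b eq = bezout≉ a b eq p≈0 d≈0
  ... | Bézout.-+ a b eq = bezout≉ b a eq d≈0 p≈0

  natK-injective-≤ : ∀ {m n} → m ℕ.≤ n → n ℕ.< p → natK cring m ≈ natK cring n → m ≡ n
  natK-injective-≤ {m} m≤n n<p eq with ℕ.m≤n⇒∃[o]m+o≡n m≤n
  ... | d , ≡.refl with d ℕ.≟ 0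
  ...   | yes ≡.refl = ≡.sym (ℕ.+-identityʳ m)
  ...   | no d≢0 = contradiction
    (∙-cancelˡ (natK cring m) _ _ (trans (sym (natK-+ m d)) (trans (sym eq) (sym (+-identityʳ _)))))
    (natK-≉0 d d≢0 (ℕ.≤-<-trans (ℕ.m≤n+m d m) n<p))

  natK-injective : ∀ {m n} → natK cring m ≈ natK cring n → m % p ≡ n % p
  natK-injective {m} {n} eq with ℕ.≤-total (m % p) (n % p)
  ... | inj₁ m≤n = natK-injective-≤ m≤n (m%n<n n p) (trans (sym (natK-% m)) (trans eq (natK-% n)))
  ... | inj₂ n≤m = ≡.sym (natK-injective-≤ n≤m (m%n<n m p) (trans (sym (natK-% n)) (trans (sym eq) (natK-% m))))

  -- With the adjugate as inverse, the trace of x g x⁻¹ is det x · tr g. The equality of traces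
  -- holds in K and descends because residues modulo p embed in K.
  conjugate⇒trace : ∀ (g h : Mat p) → ConjSL2K K g h → trℕ p h % p ≡ trℕ p g % p
  conjugate⇒trace (g₁ , g₂ , g₃ , g₄) (h₁ , h₂ , h₃ , h₄) ((a , b , c , d) , det≈1 , e₁ , _ , _ , e₄) =
    natK-injective (begin
      natK cring (toℕ h₁ ℕ.+ toℕ h₄)           ≈⟨ natK-+ (toℕ h₁) (toℕ h₄) ⟩
      ν h₁ + ν h₄                              ≈⟨ +-cong e₁ e₄ ⟨
      (a * ν g₁ + b * ν g₃) * d + (a * ν g₂ + b * ν g₄) * - c +
      ((c * ν g₁ + d * ν g₃) * - b + (c * ν g₂ + d * ν g₄) * a)
        ≈⟨ solve 8 (λ a b c d e f g h →
             (a :* e :+ b :* g) :* d :+ (a :* f :+ b :* h) :* :- c :+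
             ((c :* e :+ d :* g) :* :- b :+ (c :* f :+ d :* h) :* a) :=
             (a :* d :- b :* c) :* (e :+ h)) refl a b c d (ν g₁) (ν g₂) (ν g₃) (ν g₄) ⟩
      (a * d - b * c) * (ν g₁ + ν g₄)          ≈⟨ *-congʳ det≈1 ⟩
      1# * (ν g₁ + ν g₄)                       ≈⟨ *-identityˡ _ ⟩
      ν g₁ + ν g₄                              ≈⟨ natK-+ (toℕ g₁) (toℕ g₄) ⟨
      natK cring (toℕ g₁ ℕ.+ toℕ g₄)           ∎)
    where
    ν : Fin p → Carrier
    ν x = natK cring (toℕ x)

open import Data.Nat using (_≤_; _*_; _^_)

-- Elements of the class inside a generating set.

module ClassBound
  (p : ℕ) {{_ : NonZero p}} (p-prime : Prime p) (H : List (Mat p))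
  (H⊆SL : All (IsSL p) H) (one∈H : one p ∈ H) (generates : Generates p H)
  (τ : ℕ) (τ²≢4 : (τ * τ) % p ≢ 4 % p) (τ≢0 : τ % p ≢ 0)
  where
  open ≡ using (refl; sym; trans; cong; cong₂; subst)
  open Counting
  open PrimeField p p-prime
  open SpecialLinear₂ 𝔽ₚ

  t : Fin p
  t = τ mod p

  t≢0 : t ≢ 0ᵖ
  t≢0 eq = τ≢0 (trans (mod-injective eq) (m*n%n≡0 0 p))

  t²≢4 : t *ᵖ t ≢ ((1ᵖ +ᵖ 1ᵖ) +ᵖ 1ᵖ) +ᵖ 1ᵖ
  t²≢4 eq = τ²≢4 (mod-injective (trans (mod-* τ τ) (trans eq (sym 4-mod))))
    where
    4-mod : 4 mod p ≡ ((1ᵖ +ᵖ 1ᵖ) +ᵖ 1ᵖ) +ᵖ 1ᵖ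
    4-mod = trans (mod-+ 3 1) (cong (_+ᵖ 1ᵖ) (trans (mod-+ 2 1) (cong (_+ᵖ 1ᵖ) (mod-+ 1 1))))

  ⊗≡⊗ᶠ : ∀ x y → _⊗_ p x y ≡ x ⊗ᶠ y
  ⊗≡⊗ᶠ (a , b , c , d) (e , f , g , h) = M-≡ (mod-+ _ _) (mod-+ _ _) (mod-+ _ _) (mod-+ _ _)

  bc+1 : ∀ b c → (toℕ b * toℕ c ℕ.+ 1) mod p ≡ (b *ᵖ c) +ᵖ 1ᵖ
  bc+1 b c = mod-+ (toℕ b * toℕ c) 1

  IsSL⇒det≡1 : ∀ x → IsSL p x → det x ≡ 1ᵖ
  IsSL⇒det≡1 (a , b , c , d) sl = det≡1 {a} {b} {c} {d} (trans sl (bc+1 b c))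

  IsSL-shear : ∀ {b c} → b ≡ 0ᵖ ⊎ c ≡ 0ᵖ → IsSL p (1ᵖ , b , c , 1ᵖ)
  IsSL-shear {b} {c} bc≡0 = trans (shear bc≡0) (sym (bc+1 b c))

  fixes? : ∀ v x → Dec (Fixes v x)
  fixes? v x = Fin.any? λ k → ≡-dec Fin._≟_ Fin._≟_ (x · rep v) (k • rep v)

  CommonLine : Mat p × Mat p × Mat p → Set
  CommonLine (x , y , z) = ∃ λ v → Fixes v x × Fixes v y × Fixes v z

  -- A finite search: the plane over F_p has p + 1 lines.
  commonLine? : ∀ w → Dec (CommonLine w)
  commonLine? (x , y , z) with fixed? nothing | Fin.any? (λ s → fixed? (just s))
    where
    fixed? : ∀ v → Dec (Fixes v x × Fixes v y × Fixes v z)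
    fixed? v = fixes? v x ×-dec fixes? v y ×-dec fixes? v z
  ... | yes ∞    | _            = yes (nothing , ∞)
  ... | no _     | yes (s , fs) = yes (just s , fs)
  ... | no ∞∉    | no ∄s        = no λ { (nothing , fs) → ∞∉ fs ; (just s , fs) → ∄s (s , fs) }

  prod-fixes : ∀ {v} → All (Fixes v) H → ∀ w → All (_∈ H) w → Fixes v (prod p w)
  prod-fixes {v} fs []      []          = Fixes-I v
  prod-fixes {v} fs (x ∷ w) (x∈H ∷ w⊆H) = subst (Fixes v) (sym (⊗≡⊗ᶠ x (prod p w)))
    (Fixes-⊗ v {x} {prod p w} (All.lookup fs x∈H) (prod-fixes {v} fs w w⊆H))

  -- If all of H fixed v, so would every product of elements of H, hence both elementary unipotents,
  -- contradicting `no-common-line`.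
  moving : ∀ v → ∃ λ h → h ∈ H × ¬ Fixes v h
  moving v with All.all? (fixes? v) H
  ... | no ¬fs = find (¬All⇒Any¬ (fixes? v) H ¬fs)
  ... | yes fs = contradiction
    (fix (1ᵖ , 1ᵖ , 0ᵖ , 1ᵖ) (IsSL-shear {1ᵖ} {0ᵖ} (inj₂ refl)) ,
     fix (1ᵖ , 0ᵖ , 1ᵖ , 1ᵖ) (IsSL-shear {0ᵖ} {1ᵖ} (inj₁ refl)))
    (no-common-line v)
    where
    fix : ∀ m → IsSL p m → Fixes v m
    fix m sl with generates m sl
    ... | w , w⊆H , refl = prod-fixes {v} fs w w⊆H

  G : List (Mat p)
  G = HHH p H

  D : ℕ
  D = length G

  triple∈G : ∀ {x y z} → x ∈ H → y ∈ H → z ∈ H → x ⊗ᶠ y ⊗ᶠ z ∈ G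
  triple∈G {x} {y} {z} x∈H y∈H z∈H = ∈-deduplicate⁺ (_≟M_ p)
    (∈-concatMap⁺ (λ x → concatMap (λ y → map (λ z → _⊗_ p (_⊗_ p x y) z) H) H)
      (lose x∈H (∈-concatMap⁺ (λ y → map (λ z → _⊗_ p (_⊗_ p x y) z) H)
        (lose y∈H (subst (_∈ map (λ z → _⊗_ p (_⊗_ p x y) z) H)
          (trans (⊗≡⊗ᶠ (_⊗_ p x y) z) (cong (_⊗ᶠ z) (⊗≡⊗ᶠ x y)))
          (∈-map⁺ (λ z → _⊗_ p (_⊗_ p x y) z) z∈H))))))

  -- Products with fewer than three factors are padded with 1 ∈ H.
  pair∈G : ∀ {x y} → x ∈ H → y ∈ H → x ⊗ᶠ y ∈ G
  pair∈G x∈H y∈H = subst (_∈ G) (⊗ᶠ-identityʳ _) (triple∈G x∈H y∈H one∈H)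

  H⊆G : ∀ {x} → x ∈ H → x ∈ G
  H⊆G x∈H = subst (_∈ G) (⊗ᶠ-identityʳ _) (pair∈G x∈H one∈H)

  -- The class of g enters through its polynomial equations det = 1 and tr = t.
  Member : Mat p → Set
  Member x = x ∈ H × InClass t x

  Members : Mat p × Mat p × Mat p → Set
  Members (x , y , z) = Member x × Member y × Member z

  det-H : ∀ {h} → h ∈ H → det h ≡ 1ᵖ
  det-H {h} h∈H = IsSL⇒det≡1 h (All.lookup H⊆SL h∈H)

  IsRoot : Fin p → Set
  IsRoot k = k *ᵖ (t +ᵖ neg p k) ≡ 1ᵖ

  isRoot? : ∀ k → Dec (IsRoot k)
  isRoot? k = k *ᵖ (t +ᵖ neg p k) Fin.≟ 1ᵖ

  roots : List (Fin p)
  roots = filter isRoot? (allFin p)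

  length-roots : length roots ≤ 2
  length-roots = at-most-2 roots (filter⁺ isRoot? (allFin⁺ p)) (all-filter isRoot? (allFin p))
    where
    at-most-2 : Bounded IsRoot 2
    -- Two roots that differ from k are both equal to t - k.
    at-most-2 = Bounded-2 λ rk rl rm k≢l k≢m l≢m →
      l≢m (trans (distinct-roots rk rl k≢l) (sym (distinct-roots rk rm k≢m)))

  eigenvalue∈roots : ∀ v x k → InClass t x → Eigen x k v → k ∈ roots
  eigenvalue∈roots v x k (det-x , tr-x) xv =
    ∈-filter⁺ isRoot? (∈-allFin k) (subst (λ t → k *ᵖ (t +ᵖ neg p k) ≡ 1ᵖ) tr-x (Eigen⇒root v x k det-x xv))

  -- Serves the three coincidence cases, where two entries of the triple determine the third.
  Bounded-determined : {P : Mat p × Mat p × Mat p → Set} (f g : Mat p × Mat p × Mat p → Mat p) →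
    (∀ {w} → P w → f w ∈ G × g w ∈ G) →
    (∀ {w w′} → P w → P w′ → f w ≡ f w′ → g w ≡ g w′ → w ≡ w′) → Bounded P (D * (D * 1))
  Bounded-determined {P} f g fg∈G inj =
    Bounded-coded {R = λ a b w → P w × f w ≡ a × g w ≡ b} G G
      (λ pw → _ , _ , proj₁ (fg∈G pw) , proj₂ (fg∈G pw) , pw , refl , refl)
      (λ a b → Bounded-1 λ { (pw , fw , gw) (pw′ , fw′ , gw′) →
        inj pw pw′ (trans fw (sym fw′)) (trans gw (sym gw′)) })

  -- The five kinds of triples and their number.

  Inverse₁₂ Inverse₁₃ Equal₂₃ Degenerate Generic : Mat p × Mat p × Mat p → Set
  Inverse₁₂ w@(x , y , z) = Members w × y ≡ adj x
  Inverse₁₃ w@(x , y , z) = Members w × z ≡ adj x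
  Equal₂₃   w@(x , y , z) = Members w × y ≡ z
  Degenerate w = Members w × CommonLine w
  Generic w@(x , y , z) = Members w × y ≢ adj x × z ≢ adj x × y ≢ z × ¬ CommonLine w

  Bounded-Inverse₁₂ : Bounded Inverse₁₂ (D * (D * 1))
  Bounded-Inverse₁₂ = Bounded-determined (λ { (x , y , z) → x }) (λ { (x , y , z) → z })
    (λ { (((x∈H , _) , _ , (z∈H , _)) , _) → H⊆G x∈H , H⊆G z∈H })
    (λ { (_ , refl) (_ , refl) refl refl → refl })

  Bounded-Inverse₁₃ : Bounded Inverse₁₃ (D * (D * 1))
  Bounded-Inverse₁₃ = Bounded-determined (λ { (x , y , z) → x }) (λ { (x , y , z) → y })
    (λ { (((x∈H , _) , (y∈H , _) , _) , _) → H⊆G x∈H , H⊆G y∈H })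
    (λ { (_ , refl) (_ , refl) refl refl → refl })

  Bounded-Equal₂₃ : Bounded Equal₂₃ (D * (D * 1))
  Bounded-Equal₂₃ = Bounded-determined (λ { (x , y , z) → x }) (λ { (x , y , z) → y })
    (λ { (((x∈H , _) , (y∈H , _) , _) , _) → H⊆G x∈H , H⊆G y∈H })
    (λ { (_ , refl) (_ , refl) refl refl → refl })

  -- Given x, its eigenvalue k determines the line v, hence h = moving v; the
  -- eigenvalues l, m and the product y h z then determine y and z.
  Encodes : Mat p → Mat p → Fin p → Fin p → Fin p → Mat p × Mat p × Mat p → Set
  Encodes a b k l m w@(x , y , z) = Members w × x ≡ a × ∃ λ v →
    Eigen x k v × Eigen y l v × Eigen z m v × y ⊗ᶠ proj₁ (moving v) ⊗ᶠ z ≡ b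

  Encodes-injective : ∀ {a b k l m w w′} → Encodes a b k l m w → Encodes a b k l m w′ → w ≡ w′
  Encodes-injective {k = k} {l} {m} {x , y , z} {x′ , y′ , z′}
    (((_ , (det-x , tr-x)) , (_ , (det-y , _)) , (_ , (det-z , _))) , refl , v , xv , yv , zv , eq)
    (_ , refl , v′ , xv′ , yv′ , zv′ , eq′) =
    let y≡y′ , z≡z′ = code-injective (λ v → proj₁ (moving v)) (λ v → proj₂ (proj₂ (moving v)))
          (λ v → det-H (proj₁ (proj₂ (moving v)))) x y y′ z z′ v v′ k l m
          (λ tr²≡4 → t²≢4 (trans (cong₂ _*ᵖ_ (sym tr-x) (sym tr-x)) tr²≡4))
          det-x det-y det-z xv yv zv xv′ yv′ zv′ (trans eq (sym eq′))
    in cong₂ (λ y z → x , y , z) y≡y′ z≡z′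

  -- The two factors `D` count x and y h z, and each factor 2 counts the possible eigenvalues of one
  -- of x, y, z on the common line.
  Bounded-Degenerate : Bounded Degenerate (D * (D * (2 * (2 * (2 * 1)))))
  Bounded-Degenerate = Bounded-coded
    {R = λ a b w → Any (λ k → Any (λ l → Any (λ m → Encodes a b k l m w) roots) roots) roots} G G
    encode
    λ a b → Bounded-Any roots length-roots λ k → Bounded-Any roots length-roots λ l →
      Bounded-Any roots length-roots λ m → Bounded-1 λ {w} {w′} →
        Encodes-injective {a} {b} {k} {l} {m} {w} {w′}
    where
    encode : ∀ {w} → Degenerate w → ∃₂ λ a b → a ∈ G × b ∈ G ×
             Any (λ k → Any (λ l → Any (λ m → Encodes a b k l m w) roots) roots) roots
    encode {x , y , z} (ms@((x∈H , cx) , (y∈H , cy) , (z∈H , cz)) , v , (k , xv) , (l , yv) , (m , zv)) =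
      _ , _ , H⊆G x∈H , triple∈G y∈H (proj₁ (proj₂ (moving v))) z∈H ,
      lose (eigenvalue∈roots v x k cx xv) (lose (eigenvalue∈roots v y l cy yv) (lose (eigenvalue∈roots v z m cz zv)
        (ms , refl , v , xv , yv , zv , refl)))

  GenericOver : Mat p → Mat p → Mat p × Mat p × Mat p → Set
  GenericOver a b w@(x , y , z) = Generic w × x ⊗ᶠ y ≡ a × x ⊗ᶠ z ≡ b

  -- Within a fibre x determines y = x⁻¹a and z = x⁻¹b, so distinct triples have distinct first
  -- entries.
  GenericOver-first : ∀ {a b w w′} → GenericOver a b w → GenericOver a b w′ → w ≢ w′ → proj₁ w ≢ proj₁ w′
  GenericOver-first {w = x , _} ((((_ , (det-x , _)) , _) , _) , xy , xz) (_ , xy′ , xz′) w≢w′ refl =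
    w≢w′ (cong₂ (λ y z → x , y , z)
      (⊗-cancelˡ x det-x (trans xy (sym xy′))) (⊗-cancelˡ x det-x (trans xz (sym xz′))))

  -- Three distinct triples over one pair would give w a common line, which `Generic` excludes.
  GenericOver-fibre : ∀ {a b w w′ w″} → GenericOver a b w → GenericOver a b w′ → GenericOver a b w″ →
                      w ≢ w′ → w ≢ w″ → ¬ (w′ ≢ w″)
  GenericOver-fibre {w = w@(x , y , z)} {w′@(x′ , y′ , z′)} {w″@(x″ , y″ , z″)}
    g@((((_ , cx) , (_ , cy) , (_ , cz)) , y≢ , z≢ , y≢z , no-line) , refl , refl)
    g′@((((_ , cx′) , (_ , cy′) , (_ , cz′)) , _) , xy′ , xz′)
    g″@((((_ , cx″) , (_ , cy″) , (_ , cz″)) , _) , xy″ , xz″) w≢w′ w≢w″ w′≢w″ =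
    no-line (fibre⇒common-line x y z x′ y′ z′ x″ y″ z″ t≢0 cx cy cz cx′ cy′ cz′ cx″ cy″ cz″
      xy′ xz′ xy″ xz″ y≢ z≢ y≢z
      (GenericOver-first {w = w} {w′} g g′ w≢w′)
      (GenericOver-first {w = w} {w″} g g″ w≢w″)
      (GenericOver-first {w = w′} {w″} g′ g″ w′≢w″))

  Bounded-Generic : Bounded Generic (D * (D * 2))
  Bounded-Generic = Bounded-coded {R = GenericOver} G G
    (λ { gw@(((x∈H , _) , (y∈H , _) , (z∈H , _)) , _) →
      _ , _ , pair∈G x∈H y∈H , pair∈G x∈H z∈H , gw , refl , refl })
    (λ a b → Bounded-2 λ {w} {w′} {w″} → GenericOver-fibre {w = w} {w′} {w″})

  classify : ∀ {w} → Members w →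
             Inverse₁₂ w ⊎ Inverse₁₃ w ⊎ Equal₂₃ w ⊎ Degenerate w ⊎ Generic w
  classify {x , y , z} ms with _≟M_ p y (adj x) | _≟M_ p z (adj x) | _≟M_ p y z | commonLine? (x , y , z)
  ... | yes eq | _      | _      | _       = inj₁ (ms , eq)
  ... | no _   | yes eq | _      | _       = inj₂ (inj₁ (ms , eq))
  ... | no _   | no _   | yes eq | _       = inj₂ (inj₂ (inj₁ (ms , eq)))
  ... | no _   | no _   | no _   | yes cl  = inj₂ (inj₂ (inj₂ (inj₁ (ms , cl))))
  ... | no e₁  | no e₂  | no e₃  | no ¬cl  = inj₂ (inj₂ (inj₂ (inj₂ (ms , e₁ , e₂ , e₃ , ¬cl))))

  members-bound : ∀ L → Unique L → All Member L → length L ^ 3 ≤ 343 * D ^ 2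
  members-bound L uL mL = begin
    N ^ 3                           ≡⟨ cube N ⟩
    N * (N * N)                 ≡⟨ cong (N *_) (length-cartesianProduct L L) ⟨
    N * length L²                 ≡⟨ length-cartesianProduct L L² ⟨
    length (cartesianProduct L L²)
      ≤⟨ Bounded-mono classify (Bounded-∪ Bounded-Inverse₁₂ (Bounded-∪ Bounded-Inverse₁₃
           (Bounded-∪ Bounded-Equal₂₃ (Bounded-∪ Bounded-Degenerate Bounded-Generic))))
           (cartesianProduct L L²) (Uniqueₚ.cartesianProduct⁺ uL (Uniqueₚ.cartesianProduct⁺ uL uL))
           (Allₚ.cartesianProduct⁺ (≡.setoid _) (≡.setoid _) L L² λ x∈L yz∈L² →
             All.lookup mL x∈L , All.lookup mL (proj₁ (∈-cartesianProduct⁻ L L yz∈L²))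
                               , All.lookup mL (proj₂ (∈-cartesianProduct⁻ L L yz∈L²))) ⟩
    D * (D * 1) ℕ.+ (D * (D * 1) ℕ.+ (D * (D * 1) ℕ.+
      (D * (D * 8) ℕ.+ D * (D * 2))))
                                    ≡⟨ total D ⟩
    -- The coefficient 13 = 1 + 1 + 1 + 8 + 2 collects the five kinds; 343 is the cube of the
    -- constant 7.
    13 * D ^ 2                    ≤⟨ ℕ.*-monoˡ-≤ (D ^ 2) (ℕ.m≤m+n 13 330) ⟩
    343 * D ^ 2                   ∎
    where
    open ℕ.≤-Reasoning
    N = length L
    L² = cartesianProduct L L
    cube : ∀ n → n ^ 3 ≡ n * (n * n)
    cube n = cong (λ m → n * (n * m)) (ℕ.*-identityʳ n)
    total : ∀ d → d * (d * 1) ℕ.+ (d * (d * 1) ℕ.+ (d * (d * 1) ℕ.+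
            (d * (d * 8) ℕ.+ d * (d * 2)))) ≡ 13 * (d * (d * 1))
    total = solve-∀

-- All powers are cleared. With α = |HHH|/|H|, the cube of 7 α^(2/3) |H|^(2/3) is 343 |HHH|², and α
-- ≤ |H|^(1/28) becomes |HHH|^28 ≤ |H|^29. A duplicate-free list `L` stands for Cl(g) ∩ H because
-- conjugacy over K is not assumed decidable.
theorem3p11 : ∀ {c ℓ : Level} (p : ℕ) {{_ : NonZero p}} → Prime p → 3 ≤ p →
    (K : AlgClosedField c ℓ) → HasChar K p →
    (g : Mat p) → IsSL p g →
    (trℕ p g * trℕ p g) % p ≢ 4 % p →
    trℕ p g % p ≢ 0 →
    (H : List (Mat p)) → Unique H → All (IsSL p) H →
    one p ∈ H → Symmetric p H → Generates p H →
    length (HHH p H) ^ 28 ≤ length H ^ 29 →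
    (L : List (Mat p)) → Unique L → All (λ h → h ∈ H × ConjSL2K K g h) L →
    length L ^ 3 ≤ 343 * length (HHH p H) ^ 2
theorem3p11 p p-prime _ K char g _ tr²≢4 tr≢0 H _ H⊆SL one∈H _ generates _ L uL L⊆ =
  members-bound L uL (All.map member L⊆)
  where
  open ClassBound p p-prime H H⊆SL one∈H generates (trℕ p g) tr²≢4 tr≢0
  open PrimeField p p-prime using (mod-cong)
  open Characteristic K p p-prime char using (conjugate⇒trace)
  member : ∀ {h} → h ∈ H × ConjSL2K K g h → Member h
  member {h} (h∈H , conj) = h∈H , det-H h∈H , mod-cong (conjugate⇒trace g h conj)
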